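{- Let $r\ge 3$ and let $q$ be a prime power. Any Singer cover of $\mathrm{PG}(r,q)$ is an $(r-2)$-dual cover of $\mathrm{PG}(r,q)$.
   Context: An $n$-space is an $n$-dimensional projective subspace. $\theta_{n,q}=q^n+\dots+q+1$ for $n\ge 0$ and $\theta_{ -1,q}=0$. An $m$-cover of lines of $\mathrm{PG}(r,q)$ is a set $\mathcal L$ of lines such that every point of $\mathrm{PG}(r,q)$ lies on exactly $m$ lines of $\mathcal L$, where $0<m<\theta_{r-1,q}$. An $m$-cover $\mathcal L$ is an $(r-2)$-dual $m$-cover (or $(r-2)$-dual cover) if every $(r-2)$-space of $\mathrm{PG}(r,q)$ contains either $\frac{m\theta_{r-4,q}}{q+1}+q^{r-3}$ or $\frac{m\theta_{r-4,q}}{q+1}$ lines of $\mathcal L$. A Singer cyclic group of $\mathrm{PG}(r,q)$ is a cyclic subgroup $\mathcal K$ of $\mathrm{PGL}(r+1,q)$ acting regularly on the points of $\mathrm{PG}(r,q)$. A Singer cover of $\mathrm{PG}(r,q)$ is an orbit of $\mathcal K$ on the lines of $\mathrm{PG}(r,q)$. (It is known that if $r$ is odd, one $\mathcal K$-orbit on lines is a $1$-cover and every other one is a $(q+1)$-cover, and if $r$ is even every $\mathcal K$-orbit on lines is a $(q+1)$-cover; $m$ in the definition of $(r-2)$-dual is the corresponding value.) -}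

module Defs where

open import Algebra.Apartness.Bundles using (HeytingCommutativeRing; HeytingField)
open import Algebra.Bundles using (CommutativeRing; Group; Ring)
open import Algebra.Module.Bundles using (LeftModule)
open import Algebra.Module.Morphism.Structures using (IsLeftModuleIsomorphism)
open import Data.Fin.Base using (Fin)
open import Data.Integer.Base as ℤ using (ℤ; +_; -[1+_])
open import Data.List.Base using (applyUpTo)
open import Data.Nat.Base as ℕ using (ℕ; suc; _≤_; _<_; _∸_; _^_)
open import Data.Nat.ListAction using (sum)
open import Data.Nat.Primality using (Prime)
open import Data.Product using (Σ; ∃; ∃-syntax; ∃!; ∃₂; _×_; _,_; proj₁; proj₂)
open import Data.Rational.Base as ℚ using (ℚ)
open import Data.Sum.Base using (_⊎_)
open import Data.Unit.Base using (tt)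
open import Data.Vec.Functional using (Vector)
open import Function.Bundles using (Inverse)
open import Level using (0ℓ; _⊔_)
open import Relation.Binary.Bundles using (Setoid)
open import Relation.Binary.PropositionalEquality.Core using (_≡_)
open import Relation.Unary using (Pred; _∈_; _⊆_; _≐_; _∩_; U)
open import Relation.Unary.Properties using (≐-refl; ≐-sym; ≐-trans)
import Algebra.Apartness.Properties.HeytingCommutativeRing as HeytingProperties
import Algebra.Definitions.RawMonoid as RawMonoidDefinitions
import Algebra.Module.Morphism.Construct.Composition as Composition
import Algebra.Module.Morphism.Construct.Identity as Identity
import Algebra.Properties.CommutativeMonoid.Sum as Sum
import Relation.Binary.Construct.On as On
import Relation.Binary.PropositionalEquality.Properties as ≡
import Relation.Binary.Reasoning.Setoid as ≈-Reasoning

IsPrimePower : ℕ → Set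
IsPrimePower q = ∃₂ λ p h → Prime p × 1 ≤ h × q ≡ p ^ h

-- θ q n is qⁿ + … + q + 1 for n ≥ 0.  Among the negative indices only -1 is
-- ever used, where the value is 0.
θ : ℕ → ℤ → ℕ
θ q (+ n)    = sum (applyUpTo (q ^_) (suc n))
θ q -[1+ _ ] = 0

-- The number of elements is counted up to the setoid equality.
HasSize : ∀ {c ℓ} → Setoid c ℓ → ℕ → Set (c ⊔ ℓ)
HasSize S n = Inverse S (≡.setoid (Fin n))

fieldRing : ∀ {c ℓ₁ ℓ₂} → HeytingField c ℓ₁ ℓ₂ → Ring c ℓ₁
fieldRing F = CommutativeRing.ring
  (HeytingCommutativeRing.commutativeRing (HeytingField.heytingCommutativeRing F))

-- When the field is finite its equality is decidable, so that the apartness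
-- x # y is just x ≉ y and a Heyting field is a field in the usual sense.
FieldOfOrder : HeytingField 0ℓ 0ℓ 0ℓ → ℕ → Set
FieldOfOrder F q = HasSize (CommutativeRing.setoid commutativeRing) q
  where open HeytingCommutativeRing (HeytingField.heytingCommutativeRing F)

module _ (G : Group 0ℓ 0ℓ) where
  open Group G
  open RawMonoidDefinitions rawMonoid using () renaming (_×_ to _times_)

  record Subgroup : Set₁ where
    field
      Member    : Pred Carrier 0ℓ
      resp      : ∀ {x y} → x ≈ y → x ∈ Member → y ∈ Member
      ε-closed  : ε ∈ Member
      ∙-closed  : ∀ {x y} → x ∈ Member → y ∈ Member → x ∙ y ∈ Member
      ⁻¹-closed : ∀ {x} → x ∈ Member → x ⁻¹ ∈ Member

  infixr 8 _^ᶻ_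
  _^ᶻ_ : Carrier → ℤ → Carrier
  x ^ᶻ (+ n)    = n times x
  x ^ᶻ -[1+ n ] = suc n times (x ⁻¹)

  IsCyclic : Subgroup → Set
  IsCyclic K = ∃[ g ] g ∈ Member × (∀ {h} → h ∈ Member → ∃[ n ] h ≈ g ^ᶻ n)
    where open Subgroup K

module ProjectiveGeometry (F : HeytingField 0ℓ 0ℓ 0ℓ) (V : LeftModule (fieldRing F) 0ℓ 0ℓ) where
  open HeytingField F
  open LeftModule V
  open Sum +ᴹ-commutativeMonoid using () renaming (sum to sumᴹ)
  private
    module P = HeytingProperties heytingCommutativeRing
    module R = Ring (fieldRing F)

  lincomb : ∀ {n} → Vector Carrier n → Vector Carrierᴹ n → Carrierᴹ
  lincomb c b = sumᴹ (λ i → c i *ₗ b i)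

  LinearlyIndependent : ∀ {n} → Vector Carrierᴹ n → Set
  LinearlyIndependent b = ∀ c → lincomb c b ≈ᴹ 0ᴹ → ∀ i → c i ≈ 0#

  record Subspace : Set₁ where
    field
      Member    : Pred Carrierᴹ 0ℓ
      resp      : ∀ {x y} → x ≈ᴹ y → x ∈ Member → y ∈ Member
      0-closed  : 0ᴹ ∈ Member
      +-closed  : ∀ {x y} → x ∈ Member → y ∈ Member → x +ᴹ y ∈ Member
      *ₗ-closed : ∀ a {x} → x ∈ Member → a *ₗ x ∈ Member

  HasBasis : ∀ {n} → Pred Carrierᴹ 0ℓ → Vector Carrierᴹ n → Set
  HasBasis W b =
    (∀ i → b i ∈ W) × LinearlyIndependent b × (∀ {v} → v ∈ W → ∃[ c ] v ≈ᴹ lincomb c b)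

  HasDim : Subspace → ℕ → Set
  HasDim W n = ∃ λ (b : Vector Carrierᴹ n) → HasBasis (Subspace.Member W) b

  whole : Subspace
  whole = record
    { Member = U ; resp = λ _ _ → tt ; 0-closed = tt
    ; +-closed = λ _ _ → tt ; *ₗ-closed = λ _ _ → tt }

  ProjectiveDim : ℕ → Set
  ProjectiveDim r = HasDim whole (suc r)

  Space : ℕ → Set₁
  Space n = Σ Subspace λ W → HasDim W (suc n)

  Point Line : Set₁
  Point = Space 0
  Line  = Space 1

  vectors : ∀ {n} → Space n → Pred Carrierᴹ 0ℓ
  vectors S = Subspace.Member (proj₁ S)

  infix 4 _lies-in_ _≋_
  _lies-in_ : ∀ {m n} → Space m → Space n → Set
  S lies-in T = vectors S ⊆ vectors T

  _≋_ : ∀ {n} → Space n → Space n → Set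
  S ≋ T = vectors S ≐ vectors T

  lineSetoid : Setoid _ _
  lineSetoid = record
    { Carrier       = Line
    ; _≈_           = _≋_
    ; isEquivalence = record { refl = ≐-refl ; sym = ≐-sym ; trans = ≐-trans } }

  LineSet : Set₁
  LineSet = Pred Line 0ℓ

  #Lines : LineSet → ℕ → Set₁
  #Lines ℒ = HasSize (On.setoid {B = ∃ ℒ} lineSetoid proj₁)

  record GL : Set where
    field
      ⟦_⟧                     : Carrierᴹ → Carrierᴹ
      isLeftModuleIsomorphism : IsLeftModuleIsomorphism rawLeftModule rawLeftModule ⟦_⟧
    open IsLeftModuleIsomorphism isLeftModuleIsomorphism public

    inv : Carrierᴹ → Carrierᴹ
    inv v = proj₁ (surjective v)

    inv-right : ∀ v → ⟦ inv v ⟧ ≈ᴹ v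
    inv-right v = proj₂ (surjective v) ≈ᴹ-refl

  open GL using (⟦_⟧)

  private open module ≈ᴹ-Reasoning = ≈-Reasoning ≈ᴹ-setoid

  invGL : GL → GL
  invGL f = record
    { ⟦_⟧ = inv
    ; isLeftModuleIsomorphism = record
      { isLeftModuleMonomorphism = record
        { isLeftModuleHomomorphism = record
          { +ᴹ-isGroupHomomorphism = record
            { isMonoidHomomorphism = record
              { isMagmaHomomorphism = record
                { isRelHomomorphism = record { cong = inv-cong }
                ; homo = λ x y → injective (begin
                    ⟦ f ⟧ (inv (x +ᴹ y))           ≈⟨ inv-right _ ⟩
                    x +ᴹ y                          ≈⟨ +ᴹ-cong (inv-right x) (inv-right y) ⟨
                    ⟦ f ⟧ (inv x) +ᴹ ⟦ f ⟧ (inv y) ≈⟨ +ᴹ-homo _ _ ⟨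
                    ⟦ f ⟧ (inv x +ᴹ inv y)         ∎) }
              ; ε-homo = injective (≈ᴹ-trans (inv-right _) (≈ᴹ-sym 0ᴹ-homo)) }
            ; ⁻¹-homo = λ x → injective (begin
                ⟦ f ⟧ (inv (-ᴹ x))  ≈⟨ inv-right _ ⟩
                -ᴹ x                 ≈⟨ -ᴹ‿cong (inv-right x) ⟨
                -ᴹ ⟦ f ⟧ (inv x)    ≈⟨ -ᴹ-homo _ ⟨
                ⟦ f ⟧ (-ᴹ inv x)    ∎) }
          ; *ₗ-homo = λ a x → injective (begin
              ⟦ f ⟧ (inv (a *ₗ x)) ≈⟨ inv-right _ ⟩
              a *ₗ x                ≈⟨ *ₗ-cong R.refl (inv-right x) ⟨
              a *ₗ ⟦ f ⟧ (inv x)   ≈⟨ *ₗ-homo _ _ ⟨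
              ⟦ f ⟧ (a *ₗ inv x)   ∎) }
        ; injective = λ {x} {y} e → begin
            x              ≈⟨ inv-right x ⟨
            ⟦ f ⟧ (inv x) ≈⟨ ⟦⟧-cong e ⟩
            ⟦ f ⟧ (inv y) ≈⟨ inv-right y ⟩
            y              ∎ }
      ; surjective = λ y → ⟦ f ⟧ y , λ {z} e → injective (≈ᴹ-trans (inv-right z) e) } }
    where
      open GL f hiding (⟦_⟧)
      inv-cong : ∀ {x y} → x ≈ᴹ y → inv x ≈ᴹ inv y
      inv-cong {x} {y} e = injective (begin
        ⟦ f ⟧ (inv x) ≈⟨ inv-right x ⟩
        x              ≈⟨ e ⟩
        y              ≈⟨ inv-right y ⟨
        ⟦ f ⟧ (inv y) ∎)

  inverse# : ∀ {c} → c # 0# → ∃[ d ] d # 0# × d * c ≈ 1# × c * d ≈ 1#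
  inverse# {c} c#0 with #⇒invertible c#0
  ... | d , dc , cd = d
      , P.invertibleˡ⇒# (c , R.trans (R.*-cong R.refl (P.x-0≈x d)) cd′)
      , R.trans (R.*-cong R.refl (R.sym (P.x-0≈x c))) dc , cd′
    where cd′ = R.trans (R.*-cong (R.sym (P.x-0≈x c)) R.refl) cd

  infix 4 _∼_
  _∼_ : GL → GL → Set
  f ∼ g = ∃[ c ] c # 0# × (∀ v → ⟦ f ⟧ v ≈ᴹ c *ₗ ⟦ g ⟧ v)

  pointwise : ∀ {f g} → (∀ v → ⟦ f ⟧ v ≈ᴹ ⟦ g ⟧ v) → f ∼ g
  pointwise e = 1# , P.1#0 , λ v → ≈ᴹ-trans (e v) (≈ᴹ-sym (*ₗ-identityˡ _))

  ∼-sym : ∀ {f g} → f ∼ g → g ∼ f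
  ∼-sym {f} {g} (c , c#0 , e) with inverse# c#0
  ... | d , d#0 , dc , _ = d , d#0 , λ v → begin
    ⟦ g ⟧ v             ≈⟨ *ₗ-identityˡ _ ⟨
    1# *ₗ ⟦ g ⟧ v       ≈⟨ *ₗ-cong dc ≈ᴹ-refl ⟨
    (d * c) *ₗ ⟦ g ⟧ v  ≈⟨ *ₗ-assoc d c _ ⟩
    d *ₗ (c *ₗ ⟦ g ⟧ v) ≈⟨ *ₗ-cong R.refl (e v) ⟨
    d *ₗ ⟦ f ⟧ v        ∎

  ∼-trans : ∀ {f g h} → f ∼ g → g ∼ h → f ∼ h
  ∼-trans {f} {g} {h} (c , c#0 , e) (d , d#0 , e′) = c * d , P.x#0y#0→xy#0 c#0 d#0 , λ v → begin
    ⟦ f ⟧ v             ≈⟨ e v ⟩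
    c *ₗ ⟦ g ⟧ v        ≈⟨ *ₗ-cong R.refl (e′ v) ⟩
    c *ₗ (d *ₗ ⟦ h ⟧ v) ≈⟨ *ₗ-assoc c d _ ⟨
    (c * d) *ₗ ⟦ h ⟧ v  ∎

  idGL : GL
  idGL = record
    { ⟦_⟧ = λ v → v
    ; isLeftModuleIsomorphism = Identity.isLeftModuleIsomorphism rawLeftModule ≈ᴹ-refl }

  compose : GL → GL → GL
  compose f g = record
    { ⟦_⟧ = λ v → ⟦ f ⟧ (⟦ g ⟧ v)
    ; isLeftModuleIsomorphism = Composition.isLeftModuleIsomorphism ≈ᴹ-trans
        (GL.isLeftModuleIsomorphism g) (GL.isLeftModuleIsomorphism f) }

  compose-cong : ∀ {f f′ g g′} → f ∼ f′ → g ∼ g′ → compose f g ∼ compose f′ g′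
  compose-cong {f} {f′} {g} {g′} (c , c#0 , e) (d , d#0 , e′) =
    c * d , P.x#0y#0→xy#0 c#0 d#0 , λ v → begin
      ⟦ f ⟧ (⟦ g ⟧ v)                ≈⟨ e _ ⟩
      c *ₗ ⟦ f′ ⟧ (⟦ g ⟧ v)          ≈⟨ *ₗ-cong R.refl (GL.⟦⟧-cong f′ (e′ v)) ⟩
      c *ₗ ⟦ f′ ⟧ (d *ₗ ⟦ g′ ⟧ v)    ≈⟨ *ₗ-cong R.refl (GL.*ₗ-homo f′ d _) ⟩
      c *ₗ (d *ₗ ⟦ f′ ⟧ (⟦ g′ ⟧ v))  ≈⟨ *ₗ-assoc c d _ ⟨
      (c * d) *ₗ ⟦ f′ ⟧ (⟦ g′ ⟧ v)   ∎

  inv-cong : ∀ {f g} → f ∼ g → invGL f ∼ invGL g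
  inv-cong {f} {g} (c , c#0 , e) with inverse# c#0
  ... | d , d#0 , dc , _ = d , d#0 , λ v → GL.injective f (begin
    ⟦ f ⟧ (GL.inv f v)                 ≈⟨ GL.inv-right f v ⟩
    v                                   ≈⟨ GL.inv-right g v ⟨
    ⟦ g ⟧ (GL.inv g v)                 ≈⟨ *ₗ-identityˡ _ ⟨
    1# *ₗ ⟦ g ⟧ (GL.inv g v)           ≈⟨ *ₗ-cong dc ≈ᴹ-refl ⟨
    (d * c) *ₗ ⟦ g ⟧ (GL.inv g v)      ≈⟨ *ₗ-assoc d c _ ⟩
    d *ₗ (c *ₗ ⟦ g ⟧ (GL.inv g v))     ≈⟨ *ₗ-cong R.refl (e _) ⟨
    d *ₗ ⟦ f ⟧ (GL.inv g v)            ≈⟨ GL.*ₗ-homo f d _ ⟨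
    ⟦ f ⟧ (d *ₗ GL.inv g v)            ∎)

  -- PGL(V) is represented by GL(V) with equality up to a nonzero scalar.
  PGL : Group 0ℓ 0ℓ
  PGL = record
    { Carrier = GL
    ; _≈_     = _∼_
    ; _∙_     = compose
    ; ε       = idGL
    ; _⁻¹     = invGL
    ; isGroup = record
      { isMonoid = record
        { isSemigroup = record
          { isMagma = record
            { isEquivalence = record
              { refl  = λ {f} → pointwise {f} {f} (λ _ → ≈ᴹ-refl)
              ; sym   = λ {f} {g} → ∼-sym {f} {g}
              ; trans = λ {f} {g} {h} → ∼-trans {f} {g} {h} }
            ; ∙-cong = λ {f} {f′} {g} {g′} → compose-cong {f} {f′} {g} {g′} }
          ; assoc = λ f g h →
              pointwise {compose (compose f g) h} {compose f (compose g h)} (λ _ → ≈ᴹ-refl) }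
        ; identity = (λ f → pointwise {compose idGL f} {f} (λ _ → ≈ᴹ-refl))
                   , (λ f → pointwise {compose f idGL} {f} (λ _ → ≈ᴹ-refl)) }
      ; inverse = (λ f → pointwise {compose (invGL f) f} {idGL} (λ v → GL.injective f (GL.inv-right f _)))
                , (λ f → pointwise {compose f (invGL f)} {idGL} (GL.inv-right f))
      ; ⁻¹-cong = λ {f} {g} → inv-cong {f} {g} } }

  image : GL → Pred Carrierᴹ 0ℓ → Pred Carrierᴹ 0ℓ
  image f W v = ∃[ u ] u ∈ W × v ≈ᴹ ⟦ f ⟧ u

  infix 4 _maps_to_
  _maps_to_ : ∀ {n} → GL → Space n → Space n → Set
  f maps S to T = image f (vectors S) ≐ vectors T

  IsRegularOnPoints : Subgroup PGL → Set₁
  IsRegularOnPoints K =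
    ∀ (P Q : Point) → ∃! _∼_ λ k → k ∈ Subgroup.Member K × k maps P to Q

  IsSingerGroup : Subgroup PGL → Set₁
  IsSingerGroup K = IsCyclic PGL K × IsRegularOnPoints K

  Orbit : Subgroup PGL → Line → LineSet
  Orbit K L M = ∃[ k ] k ∈ Subgroup.Member K × k maps L to M

  IsSingerCover : LineSet → Set₁
  IsSingerCover ℒ = ∃ λ K → IsSingerGroup K × (∃[ L ] ℒ ≐ Orbit K L)

  -- V is meant to satisfy ProjectiveDim r, over a field of order q.
  module _ (r q : ℕ) where

    IsCover : ℕ → LineSet → Set₁
    IsCover m ℒ = 0 < m × m < θ q (+ r ℤ.- + 1)
      × (∀ (P : Point) → #Lines (ℒ ∩ (P lies-in_)) m)

    -- m θ_{r-4,q} / (q + 1), as a rational number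
    quotient : ℕ → ℚ
    quotient m = (+ (m ℕ.* θ q (+ r ℤ.- + 4))) ℚ./ suc q

    fromℕ : ℕ → ℚ
    fromℕ n = (+ n) ℚ./ 1

    IsDualCoverWith : ℕ → LineSet → Set₁
    IsDualCoverWith m ℒ = IsCover m ℒ
      × (∀ (S : Space (r ∸ 2)) → ∃[ N ] #Lines (ℒ ∩ (_lies-in S)) N
          × (fromℕ N ≡ quotient m ℚ.+ fromℕ (q ^ (r ∸ 3)) ⊎ fromℕ N ≡ quotient m))

    IsDualCover : LineSet → Set₁
    IsDualCover ℒ = ∃[ m ] IsDualCoverWith m ℒ

{-# OPTIONS --safe #-}
-- Fix a line L = ⟨e, u⟩.  As K is abelian and transitive on points, V becomes a field with unit e in
-- which the elements of K are, up to scalars, the multiplications by nonzero vectors.  The orbit of L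
-- thus consists of the lines xL, and xL ⊆ S means that x lies in T = S ∩ u⁻¹S.  Each line xL arises
-- from g vectors x, where g is the order of the stabiliser of L in V∖{0}, so that S contains
-- (|T| − 1)/g lines of the orbit, and every point is on m = (q² − 1)/g of them.  If u² ∈ L, then L is
-- a subfield, g = q² − 1, and T has codimension 2 or 4; otherwise g = q − 1, and T has codimension 3
-- or 4.
module Submission where

open import Algebra.Apartness.Bundles using (HeytingCommutativeRing; HeytingField)
open import Algebra.Bundles using (CommutativeRing; Group)
open import Algebra.Module.Bundles using (LeftModule)
open import Data.Fin.Base using (Fin; zero; suc; combine; punchOut; finToFun; funToFin)
open import Data.Fin.Permutation using (↔⇒≡)
open import Data.Integer.Base as ℤ using (+_; -[1+_])
open import Data.List.Base using (applyUpTo)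
open import Data.Nat.Base as ℕ using (ℕ; zero; suc; _≤_; _<_; _^_; s≤s; z≤n)
open import Data.Nat.ListAction using (sum)
open import Data.Nat.Primality using (prime⇒nonTrivial)
open import Data.Nat.Tactic.RingSolver using (solve-∀)
open import Data.Product using (∃; ∃-syntax; _×_; _,_; proj₁; proj₂; map₂)
open import Data.Product.Function.NonDependent.Setoid using (_×-inverse_)
open import Data.Product.Relation.Binary.Pointwise.NonDependent using (_×ₛ_; Pointwise-≡↔≡)
open import Data.Rational.Base as ℚ using (fromℚᵘ)
open import Data.Rational.Unnormalised.Base as ℚᵘ using (mkℚᵘ; *≡*)
open import Data.Sum.Base using (_⊎_; inj₁; inj₂)
open import Data.Unit.Base using (tt)
open import Data.Vec.Functional using (Vector; []; _∷_)
open import Function.Base using (_∘_; id)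
open import Function.Bundles using (Inverse)
open import Function.Properties.Bijection using (Bijection⇒Inverse)
open import Level using (Level; 0ℓ)
open import Relation.Binary.Bundles using (Setoid)
open import Relation.Binary.Definitions using (tri<; tri≈; tri>)
open import Relation.Binary.PropositionalEquality as ≡ using (_≡_; _≢_)
open import Relation.Binary.Structures using (IsEquivalence)
open import Relation.Nullary.Decidable using (Dec; yes; no; map′; decidable-stable; ¬?; _×-dec_)
open import Relation.Nullary.Negation using (¬_; contradiction)
open import Relation.Unary using (Decidable; Pred; _∈_; _⊆_; _≐_; _∩_)
open import Relation.Unary.Properties using (≐-refl; ≐-sym; ≐-trans)
import Algebra.Apartness.Properties.HeytingCommutativeRing as HeytingProperties
import Algebra.Definitions.RawMonoid as RawMonoidDefinitions
import Algebra.Properties.AbelianGroup as AbelianGroupProperties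
import Algebra.Properties.CommutativeMonoid.Sum as Sum
import Algebra.Properties.Ring as RingProperties
import Algebra.Solver.CommutativeMonoid as CommutativeMonoidSolver
import Data.Fin.Properties as Fin
import Data.Integer.Properties as ℤ
import Data.Nat.Properties as ℕ
import Data.Rational.Properties as ℚ
import Data.Rational.Unnormalised.Properties as ℚᵘ
import Data.Vec.Functional.Relation.Binary.Equality.Setoid as VecEq
import Function.Construct.Composition as Composition
import Function.Construct.Symmetry as Symmetry
import Relation.Binary.Construct.On as On
import Relation.Binary.Reasoning.Setoid as ≈-Reasoning
open import Defs

-- In both cases the order of T is (g + 1)qᵏ or qᵏ with k = r - 3: g + 1 is q² when codimension 2
-- can occur and q when codimension 3 can. So S contains (qᵏ - 1)/g lines of the orbit, or qᵏ more,
-- and mg = q² - 1 turns (qᵏ - 1)/g into mθ_{r-4,q}/(q + 1). The remaining codimension is ruled out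
-- in each case by a u-stable subspace H and a vector w outside it: some nonzero polynomial in u of
-- degree 1 or 2 would map w into H, yet a nonzero field element that maps the finite H into itself
-- maps no outside vector into it. Numbers of elements stand in for dimensions. S ∩ u⁻¹S comes
-- without a basis, but its order is found by search, and each vector added to a subspace multiplies
-- the order by q. Finiteness also supplies the case distinctions, as equality and membership are
-- decided by search.

-- Counting in finite setoids.

module FiniteSetoids where
  private variable
    a b ℓ ℓ′ p p′ : Level
    m n : ℕ

  Subsetoid : (S : Setoid a ℓ) → Pred (Setoid.Carrier S) p → Setoid _ _
  Subsetoid S P = On.setoid {B = ∃ P} S proj₁

  Respects : (S : Setoid a ℓ) → Pred (Setoid.Carrier S) p → Set _
  Respects S P = ∀ {x y} → Setoid._≈_ S x y → P x → P y

  Quotient : (S : Setoid a ℓ) {_~_ : Setoid.Carrier S → Setoid.Carrier S → Set ℓ′} →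
             IsEquivalence _~_ → Setoid _ _
  Quotient S eq = record { Carrier = Setoid.Carrier S ; isEquivalence = eq }

  abstract
    -- If k were missed, punching it out of the codomain would inject `Fin (suc n)` into `Fin n`.
    -- The double negation is what refutes a failed search.
    injection-hits-all : (g : Fin n → Fin n) → (∀ {i j} → g i ≡ g j → i ≡ j) →
                         ∀ k → ¬ ¬ (∃[ i ] g i ≡ k)
    injection-hits-all {suc n} g g-inj k ¬hit = ℕ.1+n≰n (Fin.injective⇒≤
      {f = λ i → punchOut {i = k} (λ e → ¬hit (i , ≡.sym e))} (λ {x} {y} e → g-inj
        (Fin.punchOut-injective (λ e → ¬hit (x , ≡.sym e)) (λ e → ¬hit (y , ≡.sym e)) e)))

    funToFin-cong : ∀ {f g : Fin m → Fin n} → (∀ i → f i ≡ g i) → funToFin f ≡ funToFin g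
    funToFin-cong {zero}  e = ≡.refl
    funToFin-cong {suc m} e = ≡.cong₂ combine (e zero) (funToFin-cong (e ∘ suc))

    module _ (S : Setoid a ℓ) (T : Setoid b ℓ′) where
      private
        module S = Setoid S
        module T = Setoid T

      bijective⇒inverse : (f : S.Carrier → T.Carrier) →
        (∀ {x y} → x S.≈ y → f x T.≈ f y) → (∀ {x y} → f x T.≈ f y → x S.≈ y) →
        (∀ y → ∃[ x ] f x T.≈ y) → Inverse S T
      bijective⇒inverse f f-cong inj surj = Bijection⇒Inverse record
        { to = f ; cong = f-cong
        ; bijective = inj , λ y → proj₁ (surj y) , λ e → T.trans (f-cong e) (proj₂ (surj y)) }

      sizes-agree : Inverse S T → HasSize S m → HasSize T n → m ≡ n
      sizes-agree i s t = ↔⇒≡ (Composition.inverse (Symmetry.inverse s) (Composition.inverse i t))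

      size-transport : Inverse S T → HasSize T n → HasSize S n
      size-transport = Composition.inverse

      size-× : HasSize S m → HasSize T n → HasSize (S ×ₛ T) (m ℕ.* n)
      size-× s t = Composition.inverse (s ×-inverse t)
        (Composition.inverse Pointwise-≡↔≡ (Symmetry.inverse Fin.*↔×))

      -- Transported to `Fin n`, a preimage is found by search, so the result is an actual witness;
      -- the pigeonhole principle rules out failure. Equality of nested subspaces of the same order
      -- and division inside a subspace rest on this.
      injective⇒surjective : HasSize S n → HasSize T n → (f : S.Carrier → T.Carrier) →
        (∀ {x y} → f x T.≈ f y → x S.≈ y) → ∀ y → ∃[ x ] f x T.≈ y
      injective⇒surjective {n} s t f inj y with Fin.any? (λ i → g i Fin.≟ Inverse.to t y)
        where
        g : Fin n → Fin n
        g i = Inverse.to t (f (Inverse.from s i))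
      ... | yes (i , e) = Inverse.from s i , T.trans (T.sym (Inverse.strictlyInverseʳ t _))
                            (T.trans (Inverse.from-cong t e) (Inverse.strictlyInverseʳ t _))
      ... | no ¬hit = contradiction ¬hit (injection-hits-all _ g-injective _)
        where
        g-injective : ∀ {i j} →
          Inverse.to t (f (Inverse.from s i)) ≡ Inverse.to t (f (Inverse.from s j)) → i ≡ j
        g-injective {i} {j} e =
          ≡.trans (≡.sym (Inverse.strictlyInverseˡ s i))
            (≡.trans (Inverse.to-cong s (inj (T.trans (T.sym (Inverse.strictlyInverseʳ t _))
              (T.trans (Inverse.from-cong t e) (Inverse.strictlyInverseʳ t _)))))
            (Inverse.strictlyInverseˡ s j))

    module _ (S : Setoid a ℓ) where
      open Setoid S

      size-unique : HasSize S m → HasSize S n → m ≡ n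
      size-unique = sizes-agree S S (bijective⇒inverse S S id id id (λ y → y , refl))

      size-≐ : {P : Pred Carrier p} {Q : Pred Carrier p′} → P ≐ Q →
               HasSize (Subsetoid S P) n → HasSize (Subsetoid S Q) n
      size-≐ {P = P} {Q} (P⊆Q , Q⊆P) = size-transport (Subsetoid S Q) (Subsetoid S P)
        (bijective⇒inverse (Subsetoid S Q) (Subsetoid S P) (map₂ Q⊆P) id id (λ (x , p) → (x , P⊆Q p) , refl))

      same-size⇒⊇ : {P : Pred Carrier p} {Q : Pred Carrier p′} → Respects S P →
        HasSize (Subsetoid S P) n → HasSize (Subsetoid S Q) n →
        (∀ {x} → P x → Q x) → ∀ {x} → Q x → P x
      same-size⇒⊇ {P = P} {Q} resp sP sQ P⊆Q {x} q
        with (y , py) , e ← injective⇒surjective (Subsetoid S P) (Subsetoid S Q) sP sQ (map₂ P⊆Q) id (x , q)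
        = resp e py

      ≈-dec : HasSize S n → ∀ x y → Dec (x ≈ y)
      ≈-dec s x y = map′ (λ e → trans (sym (Inverse.strictlyInverseʳ s x))
                             (trans (Inverse.from-cong s e) (Inverse.strictlyInverseʳ s y)))
                         (Inverse.to-cong s) (Inverse.to s x Fin.≟ Inverse.to s y)

      finite-any? : HasSize S n → {P : Pred Carrier p} → Respects S P → Decidable P → Dec (∃ P)
      finite-any? s resp P? =
        map′ (λ (i , p) → Inverse.from s i , p)
             (λ (x , p) → Inverse.to s x , resp (sym (Inverse.strictlyInverseʳ s x)) p)
             (Fin.any? (P? ∘ Inverse.from s))

      -- `e zero` adds one to the count exactly when it is selected and no later selected entry
      -- equals it. As `e` may repeat values, one induction serves decidable subsets and also
      -- quotients, where an enumeration of the setoid repeats classes.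
      size-image : (∀ x y → Dec (x ≈ y)) → ∀ n (e : Fin n → Carrier) {P : Pred (Fin n) p} → Decidable P →
        ∃[ N ] HasSize (Subsetoid S (λ x → ∃[ i ] P i × x ≈ e i)) N
      size-image _≈?_ zero e P? = zero , record
        { to = λ () ; from = λ () ; to-cong = λ { {_ , () , _} } ; from-cong = λ { {()} }
        ; inverse = (λ { {()} }) , (λ { {_ , () , _} }) }
      size-image _≈?_ (suc n) e {P} P? with size-image _≈?_ n (e ∘ suc) (P? ∘ suc)
      ... | N , s with Fin.any? (λ i → P? (suc i) ×-dec (e zero ≈? e (suc i))) | P? zero
      ... | no _ | no ¬p₀ = N , size-≐ ((λ (i , p , q) → suc i , p , q) , drop) s
        where
        drop : ∀ {x} → (∃[ i ] P i × x ≈ e i) → ∃[ i ] P (suc i) × x ≈ e (suc i)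
        drop (zero , p , _) = contradiction p ¬p₀
        drop (suc i , p , q) = i , p , q
      ... | yes (j , pj , e₀≈) | _ = N , size-≐ ((λ (i , p , q) → suc i , p , q) , drop) s
        where
        drop : ∀ {x} → (∃[ i ] P i × x ≈ e i) → ∃[ i ] P (suc i) × x ≈ e (suc i)
        drop (zero , _ , q) = j , pj , trans q e₀≈
        drop (suc i , p , q) = i , p , q
      ... | no e₀∉ | yes p₀ = suc N , Symmetry.inverse (bijective⇒inverse (≡.setoid _) _ f f-cong f-inj f-surj)
        where
        f : Fin (suc N) → ∃[ x ] ∃[ i ] P i × x ≈ e i
        f zero = e zero , zero , p₀ , refl
        f (suc k) with x , i , p , q ← Inverse.from s k = x , suc i , p , q
        f-cong : ∀ {k l} → k ≡ l → proj₁ (f k) ≈ proj₁ (f l)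
        f-cong ≡.refl = refl
        f-inj : ∀ {k l} → proj₁ (f k) ≈ proj₁ (f l) → k ≡ l
        f-inj {zero} {zero} _ = ≡.refl
        f-inj {zero} {suc l} q with x , i , p , r ← Inverse.from s l = contradiction (i , p , trans q r) e₀∉
        f-inj {suc k} {zero} q with x , i , p , r ← Inverse.from s k = contradiction (i , p , trans (sym q) r) e₀∉
        f-inj {suc k} {suc l} q = ≡.cong suc (≡.trans (≡.sym (Inverse.strictlyInverseˡ s k))
          (≡.trans (Inverse.to-cong s q) (Inverse.strictlyInverseˡ s l)))
        f-surj : ∀ y → ∃[ k ] proj₁ (f k) ≈ proj₁ y
        f-surj (x , zero , p , q) = zero , sym q
        f-surj (x , suc i , p , q) = suc (Inverse.to s y) , Inverse.strictlyInverseʳ s y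
          where y = x , i , p , q

    module _ (S : Setoid a ℓ) where
      open Setoid S

      size-decidable : HasSize S n → {P : Pred Carrier p} → Respects S P → Decidable P →
                       ∃[ m ] HasSize (Subsetoid S P) m
      size-decidable {n = n} s resp P? =
        map₂ (size-≐ S ((λ (i , p , q) → resp (sym q) p) ,
                      λ {x} p → Inverse.to s x , resp (back x) p , back x))
             (size-image S (≈-dec S s) n (Inverse.from s) (P? ∘ Inverse.from s))
        where
        back : ∀ x → x ≈ Inverse.from s (Inverse.to s x)
        back x = sym (Inverse.strictlyInverseʳ s x)

      size-quotient : HasSize S n → {_~_ : Carrier → Carrier → Set ℓ′} (eq : IsEquivalence _~_) →
        (∀ {x y} → x ≈ y → x ~ y) → (∀ x y → Dec (x ~ y)) → ∃[ N ] HasSize (Quotient S eq) N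
      size-quotient {n = n} s {_~_} eq ≈⇒~ _~?_ =
        map₂ (size-transport S/~ _ (bijective⇒inverse S/~ (Subsetoid S/~ _)
               (λ x → x , Inverse.to s x , tt , ≈⇒~ (sym (Inverse.strictlyInverseʳ s x)))
               id id (λ (x , _) → x , IsEquivalence.refl eq)))
             (size-image S/~ _~?_ n (Inverse.from s) (λ _ → yes tt))
        where
        S/~ = Quotient S eq

      size-fibres : ∀ {N k} (f : Carrier → Fin N) → (∀ {x y} → x ≈ y → f x ≡ f y) →
        (∀ i → HasSize (Subsetoid S (λ x → f x ≡ i)) k) → HasSize S (N ℕ.* k)
      size-fibres {N} {k} f f-cong s = size-transport S _ (bijective⇒inverse S (≡.setoid (Fin N) ×ₛ ≡.setoid (Fin k))
          (λ x → f x , Inverse.to (s (f x)) (x , ≡.refl))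
          (λ e → f-cong e , index-cong e (f-cong e) ≡.refl)
          (λ (e , e′) → index-injective e e′ ≡.refl)
          surj)
        (Composition.inverse Pointwise-≡↔≡ (Symmetry.inverse Fin.*↔×))
        where
        -- The sizes of the fibres over `f x` and `f y` are different terms. Naming the indices i
        -- and j separately lets their equality be matched with `refl`.
        index-cong : ∀ {x y i j} → x ≈ y → i ≡ j → {p : f x ≡ i} → f y ≡ j → {q : f y ≡ j} →
          Inverse.to (s i) (x , p) ≡ Inverse.to (s j) (y , q)
        index-cong e ≡.refl _ = Inverse.to-cong (s _) e
        index-injective : ∀ {x y i j} → i ≡ j → {p : f x ≡ i} {q : f y ≡ j} →
          Inverse.to (s i) (x , p) ≡ Inverse.to (s j) (y , q) → f y ≡ j → x ≈ y
        index-injective ≡.refl e _ = trans (sym (Inverse.strictlyInverseʳ (s _) _))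
          (trans (Inverse.from-cong (s _) e) (Inverse.strictlyInverseʳ (s _) _))
        surj : ∀ ij → ∃[ x ] _
        surj (i , j) with Inverse.from (s i) j in eq
        ... | x , ≡.refl = x , ≡.refl ,
          ≡.trans (≡.cong (Inverse.to (s i)) (≡.sym eq)) (Inverse.strictlyInverseˡ (s i) j)

      size-vectors : ∀ {q} n → HasSize S q → HasSize (VecEq.≋-setoid S n) (q ^ n)
      size-vectors n s = bijective⇒inverse (VecEq.≋-setoid S n) (≡.setoid _) (λ v → funToFin (Inverse.to s ∘ v))
        (λ e → funToFin-cong (Inverse.to-cong s ∘ e))
        (λ {v} {w} e i → trans (sym (Inverse.strictlyInverseʳ s (v i))) (trans (Inverse.from-cong s
          (≡.trans (≡.sym (Fin.finToFun-funToFin (Inverse.to s ∘ v) i))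
            (≡.trans (≡.cong (λ k → finToFun k i) e) (Fin.finToFun-funToFin (Inverse.to s ∘ w) i))))
          (Inverse.strictlyInverseʳ s (w i))))
        (λ k → (λ i → Inverse.from s (finToFun k i)) ,
          ≡.trans (funToFin-cong {n} (λ i → Inverse.strictlyInverseˡ s _)) (Fin.funToFin-finToFin {n} k))

open FiniteSetoids

-- Subspaces of a finite vector space and their orders.

module FiniteSpace (F : HeytingField 0ℓ 0ℓ 0ℓ) {q : ℕ} (sizeF : FieldOfOrder F q)
                   (V : LeftModule (fieldRing F) 0ℓ 0ℓ)
                   {r : ℕ} (dimV : ProjectiveGeometry.ProjectiveDim F V r) where
  open LeftModule V public
  open ProjectiveGeometry F V public
  open Sum +ᴹ-commutativeMonoid public using () renaming (sum to sumᴹ)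
  module R = CommutativeRing (HeytingCommutativeRing.commutativeRing (HeytingField.heytingCommutativeRing F))
  open R public using (Carrier; _≈_; _+_; _*_; -_; 0#; 1#)
  open HeytingField F using (_#_; #⇒invertible; tight)
  private
    module RP = RingProperties (fieldRing F)
    module RP+ = AbelianGroupProperties R.+-abelianGroup
    module VP = AbelianGroupProperties +ᴹ-abelianGroup
    module Sums = Sum +ᴹ-commutativeMonoid
  open module ≈ᴹ-Reasoning = ≈-Reasoning ≈ᴹ-setoid public
  open CommutativeMonoidSolver +ᴹ-commutativeMonoid public using (solve; _⊜_; _⊕_)

  abstract
    _≈?_ : ∀ x y → Dec (x ≈ y)
    _≈?_ = ≈-dec R.setoid sizeF

    -- The axioms invert only elements apart from 0, so the inverse is searched for among the
    -- finitely many scalars. If the search fails, c is not apart from 0, and tightness makes it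
    -- equal to 0.
    inverse : ∀ {c} → ¬ (c ≈ 0#) → ∃[ d ] d * c ≈ 1#
    inverse {c} c≉0 with finite-any? R.setoid sizeF {λ d → d * c ≈ 1#}
                          (λ e p → R.trans (R.*-congʳ (R.sym e)) p) (λ d → (d * c) ≈? 1#)
    ... | yes d = d
    ... | no ¬d = contradiction (proj₁ (tight c 0#) λ c#0 → ¬d (invertible c#0)) c≉0
      where
      invertible : c # 0# → ∃[ d ] d * c ≈ 1#
      invertible c#0 with d , dc , _ ← #⇒invertible c#0 =
        d , R.trans (R.*-congˡ (R.sym (R.trans (R.+-congˡ RP.-0#≈0#) (R.+-identityʳ c)))) dc

  +-cancelʳ-*ₗ : ∀ x c w → (x +ᴹ c *ₗ w) +ᴹ (- c) *ₗ w ≈ᴹ x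
  +-cancelʳ-*ₗ x c w = begin
    (x +ᴹ c *ₗ w) +ᴹ (- c) *ₗ w ≈⟨ +ᴹ-assoc x _ _ ⟩
    x +ᴹ (c *ₗ w +ᴹ (- c) *ₗ w) ≈⟨ +ᴹ-congˡ (*ₗ-distribʳ w c (- c)) ⟨
    x +ᴹ (c + - c) *ₗ w         ≈⟨ +ᴹ-congˡ (*ₗ-congʳ (R.-‿inverseʳ c)) ⟩
    x +ᴹ 0# *ₗ w                ≈⟨ +ᴹ-congˡ (*ₗ-zeroˡ w) ⟩
    x +ᴹ 0ᴹ                     ≈⟨ +ᴹ-identityʳ x ⟩
    x                           ∎

  move-*ₗ : ∀ {x y c w} → x ≈ᴹ y +ᴹ c *ₗ w → x +ᴹ (- c) *ₗ w ≈ᴹ y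
  move-*ₗ e = ≈ᴹ-trans (+ᴹ-congʳ e) (+-cancelʳ-*ₗ _ _ _)

  *ₗ-cancelˡ : ∀ {c d x} → d * c ≈ 1# → d *ₗ (c *ₗ x) ≈ᴹ x
  *ₗ-cancelˡ {c} {d} {x} dc = ≈ᴹ-trans (≈ᴹ-sym (*ₗ-assoc d c x)) (≈ᴹ-trans (*ₗ-congʳ dc) (*ₗ-identityˡ x))

  torsion-free : ∀ {c x} → ¬ (x ≈ᴹ 0ᴹ) → c *ₗ x ≈ᴹ 0ᴹ → c ≈ 0#
  torsion-free {c} {x} x≉0 cx≈0 = decidable-stable (c ≈? 0#) λ c≉0 → let d , dc = inverse c≉0 in
    x≉0 (≈ᴹ-trans (≈ᴹ-sym (*ₗ-cancelˡ dc)) (≈ᴹ-trans (*ₗ-congˡ cx≈0) (*ₗ-zeroʳ d)))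

  HasOrder : Pred Carrierᴹ 0ℓ → ℕ → Set
  HasOrder W = HasSize (Subsetoid ≈ᴹ-setoid W)

  module _ {n} (b : Vector Carrierᴹ n) where
    lincomb-cong : ∀ {c d} → (∀ i → c i ≈ d i) → lincomb c b ≈ᴹ lincomb d b
    lincomb-cong e = Sums.sum-cong-≋ (λ i → *ₗ-congʳ (e i))

    lincomb-+ : ∀ c d → lincomb (λ i → c i + d i) b ≈ᴹ lincomb c b +ᴹ lincomb d b
    lincomb-+ c d = ≈ᴹ-trans (Sums.sum-cong-≋ (λ i → *ₗ-distribʳ (b i) (c i) (d i)))
      (Sums.∑-distrib-+ (λ i → c i *ₗ b i) _)

  lincomb-map : ∀ {f : Carrierᴹ → Carrierᴹ} → f 0ᴹ ≈ᴹ 0ᴹ → (∀ x y → f (x +ᴹ y) ≈ᴹ f x +ᴹ f y) →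
    (∀ a x → f (a *ₗ x) ≈ᴹ a *ₗ f x) → ∀ {n} c (b : Vector Carrierᴹ n) →
    f (lincomb c b) ≈ᴹ lincomb c (f ∘ b)
  lincomb-map f0 f+ f* {zero} c b = f0
  lincomb-map f0 f+ f* {suc n} c b = ≈ᴹ-trans (f+ _ _)
    (+ᴹ-cong (f* _ _) (lincomb-map f0 f+ f* (c ∘ suc) (b ∘ suc)))

  lincomb∈ : ∀ (W : Subspace) {n} c (b : Vector Carrierᴹ n) → (∀ i → Subspace.Member W (b i)) →
             Subspace.Member W (lincomb c b)
  lincomb∈ W {zero} c b b∈ = Subspace.0-closed W
  lincomb∈ W {suc n} c b b∈ = Subspace.+-closed W (Subspace.*ₗ-closed W _ (b∈ zero))
    (lincomb∈ W (c ∘ suc) (b ∘ suc) (b∈ ∘ suc))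

  basis-injective : ∀ {n} {b : Vector Carrierᴹ n} → LinearlyIndependent b →
    ∀ {c d} → lincomb c b ≈ᴹ lincomb d b → ∀ i → c i ≈ d i
  basis-injective {n} {b} indep {c} {d} e i =
    RP+.x∙y⁻¹≈ε⇒x≈y _ _ (indep (λ i → c i + - d i) (begin
      lincomb (λ i → c i + - d i) b ≈⟨ lincomb-+ b c _ ⟩
      lincomb c b +ᴹ lincomb (-_ ∘ d) b ≈⟨ +ᴹ-congʳ e ⟩
      lincomb d b +ᴹ lincomb (-_ ∘ d) b ≈⟨ lincomb-+ b d _ ⟨
      lincomb (λ i → d i + - d i) b     ≈⟨ lincomb-cong b (λ i → R.-‿inverseʳ (d i)) ⟩
      lincomb (λ i → 0#) b          ≈⟨ Sums.sum-cong-≋ {n} (λ i → *ₗ-zeroˡ (b i)) ⟩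
      sumᴹ {n} (λ i → 0ᴹ) ≈⟨ Sums.sum-replicate-zero n ⟩
      0ᴹ ∎) i)

  abstract
    size-subspace : ∀ (W : Subspace) {n} → HasDim W n → HasOrder (Subspace.Member W) (q ^ n)
    size-subspace W {n} (b , b∈ , indep , spans) = size-transport
      (Subsetoid ≈ᴹ-setoid (Subspace.Member W)) (VecEq.≋-setoid R.setoid n)
      (bijective⇒inverse _ _ (proj₁ ∘ spans ∘ proj₂)
        (λ {(_ , v)} {(_ , w)} e → basis-injective indep
          (≈ᴹ-trans (≈ᴹ-sym (proj₂ (spans v))) (≈ᴹ-trans e (proj₂ (spans w)))))
        (λ {(_ , v)} {(_ , w)} e → ≈ᴹ-trans (proj₂ (spans v))
          (≈ᴹ-trans (lincomb-cong b e) (≈ᴹ-sym (proj₂ (spans w)))))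
        (λ c → (lincomb c b , lincomb∈ W c b b∈) , basis-injective indep (≈ᴹ-sym (proj₂ (spans _)))))
      (size-vectors R.setoid n sizeF)

    sizeV : HasSize ≈ᴹ-setoid (q ^ suc r)
    sizeV = size-transport _ _ (bijective⇒inverse ≈ᴹ-setoid (Subsetoid ≈ᴹ-setoid _)
      (_, tt) id id (λ (v , _) → v , ≈ᴹ-refl)) (size-subspace whole dimV)

    _≈ᴹ?_ : ∀ x y → Dec (x ≈ᴹ y)
    _≈ᴹ?_ = ≈-dec ≈ᴹ-setoid sizeV

    member? : ∀ (W : Subspace) {n} → HasDim W n → Decidable (Subspace.Member W)
    member? W {n} (b , b∈ , indep , spans) v = map′
      (λ (c , e) → Subspace.resp W (≈ᴹ-sym e) (lincomb∈ W c b b∈)) spans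
      (finite-any? (VecEq.≋-setoid R.setoid n) (size-vectors R.setoid n sizeF)
        (λ e p → ≈ᴹ-trans p (lincomb-cong b e)) (λ c → v ≈ᴹ? lincomb c b))

  infixl 6 _⊕⟨_⟩
  _⊕⟨_⟩ : Subspace → Carrierᴹ → Subspace
  W ⊕⟨ w ⟩ = record
    { Member = λ v → ∃[ c ] ∃[ s ] Subspace.Member W s × v ≈ᴹ s +ᴹ c *ₗ w
    ; resp = λ e (c , s , s∈ , p) → c , s , s∈ , ≈ᴹ-trans (≈ᴹ-sym e) p
    ; 0-closed = 0# , 0ᴹ , Subspace.0-closed W , ≈ᴹ-sym (≈ᴹ-trans (+ᴹ-congˡ (*ₗ-zeroˡ w)) (+ᴹ-identityˡ _))
    ; +-closed = λ (c , s , s∈ , p) (d , t , t∈ , p′) → c + d , s +ᴹ t , Subspace.+-closed W s∈ t∈ ,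
        ≈ᴹ-trans (+ᴹ-cong p p′) (≈ᴹ-trans
          (solve 4 (λ s x t y → (s ⊕ x) ⊕ (t ⊕ y) ⊜ (s ⊕ t) ⊕ (x ⊕ y)) ≈ᴹ-refl s (c *ₗ w) t (d *ₗ w))
          (+ᴹ-congˡ (≈ᴹ-sym (*ₗ-distribʳ w c d))))
    ; *ₗ-closed = λ a (c , s , s∈ , p) → a * c , a *ₗ s , Subspace.*ₗ-closed W a s∈ ,
        ≈ᴹ-trans (*ₗ-congˡ p) (≈ᴹ-trans (*ₗ-distribˡ a s _) (+ᴹ-congˡ (≈ᴹ-sym (*ₗ-assoc a c w)))) }

  module _ (W : Subspace) where
    open Subspace W

    ⊕⟨⟩-⊇ : ∀ w {v} → Member v → Subspace.Member (W ⊕⟨ w ⟩) v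
    ⊕⟨⟩-⊇ w v∈ = 0# , _ , v∈ , ≈ᴹ-sym (≈ᴹ-trans (+ᴹ-congˡ (*ₗ-zeroˡ w)) (+ᴹ-identityʳ _))

    ∈⊕⟨⟩ : ∀ w → Subspace.Member (W ⊕⟨ w ⟩) w
    ∈⊕⟨⟩ w = 1# , 0ᴹ , 0-closed , ≈ᴹ-sym (≈ᴹ-trans (+ᴹ-identityˡ _) (*ₗ-identityˡ w))

    ⊕⟨⟩-⊆ : ∀ (W′ : Subspace) {w} → Member ⊆ Subspace.Member W′ → Subspace.Member W′ w →
            Subspace.Member (W ⊕⟨ w ⟩) ⊆ Subspace.Member W′
    ⊕⟨⟩-⊆ W′ W⊆ w∈ (c , s , s∈ , e) = Subspace.resp W′ (≈ᴹ-sym e)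
      (Subspace.+-closed W′ (W⊆ s∈) (Subspace.*ₗ-closed W′ c w∈))

    abstract
      -- The coordinates c and s of a vector s + cw are unique: a second representation t + dw puts
      -- (d - c)w into W, and w ∉ W forces c = d. This factor q takes the place of the dimension
      -- formula.
      size-⊕⟨⟩ : ∀ {w n} → ¬ Member w → HasOrder Member n → HasOrder (Subspace.Member (W ⊕⟨ w ⟩)) (q ℕ.* n)
      size-⊕⟨⟩ {w} w∉ sW = size-transport _ (R.setoid ×ₛ Subsetoid ≈ᴹ-setoid Member)
        (bijective⇒inverse (Subsetoid ≈ᴹ-setoid (Subspace.Member (W ⊕⟨ w ⟩))) _
          (λ (v , c , s , s∈ , e) → c , s , s∈)
          (λ {(_ , c , s , s∈ , e)} {(_ , d , t , t∈ , e′)} e″ →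
            coefficients s∈ t∈ (≈ᴹ-trans (≈ᴹ-sym e) (≈ᴹ-trans e″ e′)))
          (λ {(_ , c , s , s∈ , e)} {(_ , d , t , t∈ , e′)} (c≈d , s≈t) →
            ≈ᴹ-trans e (≈ᴹ-trans (+ᴹ-cong s≈t (*ₗ-congʳ c≈d)) (≈ᴹ-sym e′)))
          (λ (c , s , s∈) → (s +ᴹ c *ₗ w , c , s , s∈ , ≈ᴹ-refl) , R.refl , ≈ᴹ-refl))
        (size-× R.setoid _ sizeF sW)
        where
        coefficients : ∀ {c d s t} → Member s → Member t → s +ᴹ c *ₗ w ≈ᴹ t +ᴹ d *ₗ w → c ≈ d × s ≈ᴹ t
        coefficients {c} {d} {s} {t} s∈ t∈ e = c≈d ,
          VP.∙-cancelʳ _ _ _ (≈ᴹ-trans e (+ᴹ-congˡ (*ₗ-congʳ (R.sym c≈d))))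
          where
          a : Carrier
          a = d + - c
          s≈ : s ≈ᴹ t +ᴹ a *ₗ w
          s≈ = begin
            s                              ≈⟨ +-cancelʳ-*ₗ s c w ⟨
            (s +ᴹ c *ₗ w) +ᴹ (- c) *ₗ w    ≈⟨ +ᴹ-congʳ e ⟩
            (t +ᴹ d *ₗ w) +ᴹ (- c) *ₗ w    ≈⟨ +ᴹ-assoc _ _ _ ⟩
            t +ᴹ (d *ₗ w +ᴹ (- c) *ₗ w)    ≈⟨ +ᴹ-congˡ (*ₗ-distribʳ w d (- c)) ⟨
            t +ᴹ a *ₗ w ∎
          aw∈ : Member (a *ₗ w)
          aw∈ = resp (begin
            s +ᴹ (- 1#) *ₗ t            ≈⟨ +ᴹ-congʳ (≈ᴹ-trans s≈ (+ᴹ-comm t _)) ⟩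
            (a *ₗ w +ᴹ t) +ᴹ (- 1#) *ₗ t ≈⟨ move-*ₗ (+ᴹ-congˡ (≈ᴹ-sym (*ₗ-identityˡ t))) ⟩
            a *ₗ w ∎) (+-closed s∈ (*ₗ-closed (- 1#) t∈))
          a≈0 : a ≈ 0#
          a≈0 = decidable-stable (a ≈? 0#) λ a≉0 → let b , ba = inverse a≉0 in
            w∉ (resp (*ₗ-cancelˡ ba) (*ₗ-closed b aw∈))
          c≈d : c ≈ d
          c≈d = R.sym (RP+.x∙y⁻¹≈ε⇒x≈y d c a≈0)

  0-space : Subspace
  0-space = record
    { Member = _≈ᴹ 0ᴹ ; resp = λ e p → ≈ᴹ-trans (≈ᴹ-sym e) p ; 0-closed = ≈ᴹ-refl
    ; +-closed = λ e e′ → ≈ᴹ-trans (+ᴹ-cong e e′) (+ᴹ-identityˡ _)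
    ; *ₗ-closed = λ a e → ≈ᴹ-trans (*ₗ-congˡ e) (*ₗ-zeroʳ a) }

  abstract
    size-0-space : HasOrder (_≈ᴹ 0ᴹ) 1
    size-0-space = bijective⇒inverse (Subsetoid ≈ᴹ-setoid (_≈ᴹ 0ᴹ)) (≡.setoid (Fin 1)) (λ _ → zero) (λ _ → ≡.refl)
      (λ {(_ , e)} {(_ , e′)} _ → ≈ᴹ-trans e (≈ᴹ-sym e′)) (λ { zero → (0ᴹ , ≈ᴹ-refl) , ≡.refl })

  HasNonzeroOrder : Pred Carrierᴹ 0ℓ → ℕ → Set
  HasNonzeroOrder W = HasOrder (λ v → ¬ (v ≈ᴹ 0ᴹ) × W v)

  abstract
    -- Putting `0ᴹ` in front of an enumeration of the nonzero members enumerates W. The form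
    -- `suc m ≡ n` keeps truncated subtraction out of all later counts.
    size-nonzero : ∀ (W : Subspace) {n} → HasOrder (Subspace.Member W) n →
      ∃[ m ] HasNonzeroOrder (Subspace.Member W) m × suc m ≡ n
    size-nonzero W {n} s =
      let m , s′ = size-decidable (Subsetoid ≈ᴹ-setoid Member) s {λ (v , _) → ¬ (v ≈ᴹ 0ᴹ)}
                    (λ e ¬p p → ¬p (≈ᴹ-trans e p)) (λ (v , _) → ¬? (v ≈ᴹ? 0ᴹ))
      in m , size-transport _ _ (bijective⇒inverse (Subsetoid ≈ᴹ-setoid (λ v → ¬ (v ≈ᴹ 0ᴹ) × Member v))
          (Subsetoid (Subsetoid ≈ᴹ-setoid Member) (λ (v , _) → ¬ (v ≈ᴹ 0ᴹ)))
          (λ (v , p , v∈) → (v , v∈) , p) id id (λ ((v , v∈) , p) → (v , p , v∈) , ≈ᴹ-refl)) s′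
        , sizes-agree (≡.setoid (Fin (suc m))) (Subsetoid ≈ᴹ-setoid Member)
            (bijective⇒inverse _ _ (f s′) (λ {i} {j} → f-cong s′ {i} {j}) (f-inj s′) (f-surj s′)) id-size s
      where
      open Subspace W
      id-size : ∀ {k} → HasSize (≡.setoid (Fin k)) k
      id-size = bijective⇒inverse _ _ id id id (λ i → i , ≡.refl)
      module _ {m} (s′ : HasSize (Subsetoid (Subsetoid ≈ᴹ-setoid Member) (λ (v , _) → ¬ (v ≈ᴹ 0ᴹ))) m) where
        f : Fin (suc m) → ∃ Member
        f zero = 0ᴹ , 0-closed
        f (suc i) = proj₁ (Inverse.from s′ i)
        f-cong : ∀ {i j} → i ≡ j → proj₁ (f i) ≈ᴹ proj₁ (f j)
        f-cong ≡.refl = ≈ᴹ-refl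
        f-inj : ∀ {i j} → proj₁ (f i) ≈ᴹ proj₁ (f j) → i ≡ j
        f-inj {zero} {zero} e = ≡.refl
        f-inj {zero} {suc j} e = contradiction (≈ᴹ-sym e) (proj₂ (Inverse.from s′ j))
        f-inj {suc i} {zero} e = contradiction e (proj₂ (Inverse.from s′ i))
        f-inj {suc i} {suc j} e = ≡.cong suc (≡.trans (≡.sym (Inverse.strictlyInverseˡ s′ i))
          (≡.trans (Inverse.to-cong s′ e) (Inverse.strictlyInverseˡ s′ j)))
        f-surj : ∀ v → ∃[ i ] proj₁ (f i) ≈ᴹ proj₁ v
        f-surj (v , v∈) with v ≈ᴹ? 0ᴹ
        ... | yes e = zero , ≈ᴹ-sym e
        ... | no v≉0 = suc (Inverse.to s′ ((v , v∈) , v≉0)) , Inverse.strictlyInverseʳ s′ ((v , v∈) , v≉0)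

-- The field structure that a Singer group gives to V.

module SingerField (F : HeytingField 0ℓ 0ℓ 0ℓ) {q : ℕ} (sizeF : FieldOfOrder F q)
                   (V : LeftModule (fieldRing F) 0ℓ 0ℓ)
                   {r : ℕ} (dimV : ProjectiveGeometry.ProjectiveDim F V r) where
  open FiniteSpace F sizeF V dimV public
  open GL using (⟦_⟧)

  -- Congruence is recorded in the second argument: the product built from K selects a group element
  -- for each representative of its first argument, and congruence there is recovered from
  -- commutativity.
  record FieldStructure (_·_ : Carrierᴹ → Carrierᴹ → Carrierᴹ) (1ᴹ : Carrierᴹ) : Set where
    field
      ·-congˡ : ∀ {x y z} → y ≈ᴹ z → x · y ≈ᴹ x · z
      ·-comm : ∀ x y → x · y ≈ᴹ y · x
      ·-assoc : ∀ x y z → (x · y) · z ≈ᴹ x · (y · z)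
      ·-distribˡ : ∀ x y z → x · (y +ᴹ z) ≈ᴹ x · y +ᴹ x · z
      ·-*ₗ : ∀ x a y → x · (a *ₗ y) ≈ᴹ a *ₗ (x · y)
      ·-identityʳ : ∀ x → x · 1ᴹ ≈ᴹ x
      ·-inverse : ∀ {x} → ¬ (x ≈ᴹ 0ᴹ) → ∃[ y ] x · y ≈ᴹ 1ᴹ
      1≉0 : ¬ (1ᴹ ≈ᴹ 0ᴹ)

  Commute : GL → GL → Set
  Commute f g = ∀ v → ⟦ f ⟧ (⟦ g ⟧ v) ≈ᴹ ⟦ g ⟧ (⟦ f ⟧ v)

  module _ {f : GL} where
    private module f = GL f

    commute-∼ : ∀ {g h} → g ∼ h → Commute f h → Commute f g
    commute-∼ {g} {h} (c , _ , g≈ch) fh v = begin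
      ⟦ f ⟧ (⟦ g ⟧ v)        ≈⟨ f.⟦⟧-cong (g≈ch v) ⟩
      ⟦ f ⟧ (c *ₗ ⟦ h ⟧ v)   ≈⟨ f.*ₗ-homo c _ ⟩
      c *ₗ ⟦ f ⟧ (⟦ h ⟧ v)   ≈⟨ *ₗ-congˡ (fh v) ⟩
      c *ₗ ⟦ h ⟧ (⟦ f ⟧ v)   ≈⟨ g≈ch _ ⟨
      ⟦ g ⟧ (⟦ f ⟧ v)        ∎

    commute-invGL : ∀ {g} → Commute f g → Commute f (invGL g)
    commute-invGL {g} fg v = GL.injective g (begin
      ⟦ g ⟧ (⟦ f ⟧ (GL.inv g v)) ≈⟨ fg _ ⟨
      ⟦ f ⟧ (⟦ g ⟧ (GL.inv g v)) ≈⟨ f.⟦⟧-cong (GL.inv-right g v) ⟩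
      ⟦ f ⟧ v                    ≈⟨ GL.inv-right g _ ⟨
      ⟦ g ⟧ (GL.inv g (⟦ f ⟧ v)) ∎)

    commute-times : ∀ {g} → Commute f g → ∀ n →
      Commute f (RawMonoidDefinitions._×_ (Group.rawMonoid PGL) n g)
    commute-times fg zero v = ≈ᴹ-refl
    commute-times {g} fg (suc n) v = ≈ᴹ-trans (fg _) (GL.⟦⟧-cong g (commute-times fg n v))

    commute-^ᶻ : ∀ {g} → Commute f g → ∀ n → Commute f (_^ᶻ_ PGL g n)
    commute-^ᶻ fg (+ n) = commute-times fg n
    commute-^ᶻ {g} fg -[1+ n ] = commute-times {invGL g} (commute-invGL {g} fg) (suc n)

  -- An abelian subgroup of PGL(V) has representatives that commute only up to a scalar. Here all of
  -- them are scalar multiples of powers of one linear map h, so they commute exactly: f commutes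
  -- with h, hence with the powers of h, hence with g.
  cyclic⇒commutative : ∀ {K} → IsCyclic PGL K → ∀ {f g} →
    f ∈ Subgroup.Member K → g ∈ Subgroup.Member K → Commute f g
  cyclic⇒commutative {K} (h , _ , generates) {f} {g} f∈ g∈ =
    let m , f∼ = generates f∈
        n , g∼ = generates g∈
        h-f : Commute h f
        h-f = commute-∼ {h} {f} {_^ᶻ_ PGL h m} f∼ (commute-^ᶻ {h} {h} (λ _ → ≈ᴹ-refl) m)
    in commute-∼ {f} {g} {_^ᶻ_ PGL h n} g∼ (commute-^ᶻ {f} {h} (λ v → ≈ᴹ-sym (h-f v)) n)

  span₁ : ∀ {v} → ¬ (v ≈ᴹ 0ᴹ) → Point
  span₁ {v} v≉0 = 0-space ⊕⟨ v ⟩ , (λ _ → v) , (λ _ → ∈⊕⟨⟩ 0-space v)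
    , (λ { c e zero → torsion-free v≉0 (≈ᴹ-trans (≈ᴹ-sym (+ᴹ-identityʳ _)) e) })
    , λ (c , s , s≈0 , e) → (λ _ → c) ,
        ≈ᴹ-trans e (≈ᴹ-trans (+ᴹ-congʳ s≈0) (+ᴹ-comm _ _))

  module _ {K : Subgroup PGL} (cyclic : IsCyclic PGL K) (regular : IsRegularOnPoints K)
           {e : Carrierᴹ} (e≉0 : ¬ (e ≈ᴹ 0ᴹ)) where
    private
      open Subgroup K using (Member)
      commutes = cyclic⇒commutative {K} cyclic

    abstract
      private
        -- Some k in K takes the point ⟨e⟩ to ⟨v⟩, so v is a scalar multiple of ke. The zero vector
        -- spans no point; coefficient 0 lets it define a multiplication too.
        reach : ∀ v → ∃[ c ] ∃[ k ] k ∈ Member × v ≈ᴹ c *ₗ ⟦ k ⟧ e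
        reach v with v ≈ᴹ? 0ᴹ
        ... | yes v≈0 = 0# , idGL , Subgroup.ε-closed K , ≈ᴹ-trans v≈0 (≈ᴹ-sym (*ₗ-zeroˡ e))
        ... | no v≉0
            with k , (k∈ , _ , ⊆image) , _ ← regular (span₁ e≉0) (span₁ v≉0)
            with u , (c , s , s≈0 , u≈) , v≈ku ← ⊆image (∈⊕⟨⟩ 0-space v)
          = c , k , k∈ , (begin
              v                 ≈⟨ v≈ku ⟩
              ⟦ k ⟧ u           ≈⟨ GL.⟦⟧-cong k (≈ᴹ-trans u≈ (≈ᴹ-trans (+ᴹ-congʳ s≈0) (+ᴹ-identityˡ _))) ⟩
              ⟦ k ⟧ (c *ₗ e)    ≈⟨ GL.*ₗ-homo k c e ⟩
              c *ₗ ⟦ k ⟧ e      ∎)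

        coeff : Carrierᴹ → Carrier
        coeff x = proj₁ (reach x)
        elt : Carrierᴹ → GL
        elt x = proj₁ (proj₂ (reach x))
        elt∈ : ∀ x → elt x ∈ Member
        elt∈ x = proj₁ (proj₂ (proj₂ (reach x)))

      infixl 7 _·_
      -- Multiplication by x is a scalar multiple of an element of K, chosen so that it takes e to
      -- x; thus e is a right unit by construction.
      _·_ : Carrierᴹ → Carrierᴹ → Carrierᴹ
      x · y = coeff x *ₗ ⟦ elt x ⟧ y

      private
        ·-e : ∀ x → x · e ≈ᴹ x
        ·-e x = ≈ᴹ-sym (proj₂ (proj₂ (proj₂ (reach x))))

        *ₗ-swap : ∀ a b x → a *ₗ (b *ₗ x) ≈ᴹ b *ₗ (a *ₗ x)
        *ₗ-swap a b x = begin
          a *ₗ (b *ₗ x) ≈⟨ *ₗ-assoc a b x ⟨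
          (a * b) *ₗ x  ≈⟨ *ₗ-congʳ (R.*-comm a b) ⟩
          (b * a) *ₗ x  ≈⟨ *ₗ-assoc b a x ⟩
          b *ₗ (a *ₗ x) ∎

        ·-cong : ∀ {x y z} → y ≈ᴹ z → x · y ≈ᴹ x · z
        ·-cong {x} p = *ₗ-congˡ (GL.⟦⟧-cong (elt x) p)

        ·-scale : ∀ x a y → x · (a *ₗ y) ≈ᴹ a *ₗ (x · y)
        ·-scale x a y = ≈ᴹ-trans (*ₗ-congˡ (GL.*ₗ-homo (elt x) a y)) (*ₗ-swap (coeff x) a _)

        ·-K : ∀ {k} x y → k ∈ Member → x · ⟦ k ⟧ y ≈ᴹ ⟦ k ⟧ (x · y)
        ·-K {k} x y k∈ = ≈ᴹ-trans (*ₗ-congˡ (commutes (elt∈ x) k∈ y)) (≈ᴹ-sym (GL.*ₗ-homo k _ _))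

        -- Multiplications commute as linear maps because their group elements do. Putting z = e
        -- gives commutativity of the product, and the two laws together give associativity.
        ·-swap : ∀ x y z → x · (y · z) ≈ᴹ y · (x · z)
        ·-swap x y z = ≈ᴹ-trans (·-scale x (coeff y) _) (*ₗ-congˡ (·-K x z (elt∈ y)))

        comm : ∀ x y → x · y ≈ᴹ y · x
        comm x y = begin
          x · y        ≈⟨ ·-cong {x} (·-e y) ⟨
          x · (y · e)  ≈⟨ ·-swap x y e ⟩
          y · (x · e)  ≈⟨ ·-cong {y} (·-e x) ⟩
          y · x        ∎

      K-mult : ∀ {k} → k ∈ Member → ∀ v → ⟦ k ⟧ v ≈ᴹ ⟦ k ⟧ e · v
      K-mult {k} k∈ v = begin
        ⟦ k ⟧ v         ≈⟨ GL.⟦⟧-cong k (·-e v) ⟨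
        ⟦ k ⟧ (v · e)   ≈⟨ ·-K v e k∈ ⟨
        v · ⟦ k ⟧ e     ≈⟨ comm v _ ⟩
        ⟦ k ⟧ e · v     ∎

      mult-K : ∀ {x} → ¬ (x ≈ᴹ 0ᴹ) → ∃[ k ] k ∈ Member ×
        ∃[ c ] ∃[ d ] d * c ≈ 1# × (∀ v → x · v ≈ᴹ c *ₗ ⟦ k ⟧ v)
      mult-K {x} x≉0 = elt x , elt∈ x , coeff x , map₂ (_, λ _ → ≈ᴹ-refl) (inverse λ c≈0 →
        x≉0 (≈ᴹ-trans (≈ᴹ-sym (·-e x)) (≈ᴹ-trans (*ₗ-congʳ c≈0) (*ₗ-zeroˡ _))))

      fieldStructure : FieldStructure _·_ e
      fieldStructure = record
        { ·-congˡ = λ {x} → ·-cong {x}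
        ; ·-comm = comm
        ; ·-assoc = λ x y z → begin
            (x · y) · z  ≈⟨ comm (x · y) z ⟩
            z · (x · y)  ≈⟨ ·-swap z x y ⟩
            x · (z · y)  ≈⟨ ·-cong {x} (comm z y) ⟩
            x · (y · z)  ∎
        ; ·-distribˡ = λ x y z → ≈ᴹ-trans (*ₗ-congˡ (GL.+ᴹ-homo (elt x) y z)) (*ₗ-distribˡ _ _ _)
        ; ·-*ₗ = ·-scale
        ; ·-identityʳ = ·-e
        ; ·-inverse = λ {x} x≉0 → let k , k∈ , c , d , dc , x· = mult-K x≉0 in
            d *ₗ GL.inv k e , (begin
              x · (d *ₗ GL.inv k e)        ≈⟨ ·-scale x d _ ⟩
              d *ₗ (x · GL.inv k e)        ≈⟨ *ₗ-congˡ (x· _) ⟩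
              d *ₗ (c *ₗ ⟦ k ⟧ (GL.inv k e)) ≈⟨ *ₗ-cancelˡ dc ⟩
              ⟦ k ⟧ (GL.inv k e)           ≈⟨ GL.inv-right k e ⟩
              e                            ∎)
        ; 1≉0 = e≉0 }

-- Cancellation and division in the field V.

module Field (F : HeytingField 0ℓ 0ℓ 0ℓ) {q : ℕ} (sizeF : FieldOfOrder F q) (1<q : 1 ℕ.< q)
             (V : LeftModule (fieldRing F) 0ℓ 0ℓ)
             {k : ℕ} (dimV : ProjectiveGeometry.ProjectiveDim F V (3 ℕ.+ k)) where
  open SingerField F sizeF V dimV public

  q^-injective : ∀ {m n} → q ^ m ≡ q ^ n → m ≡ n
  q^-injective {m} {n} e with ℕ.<-cmp m n
  ... | tri< m<n _ _ = contradiction e (ℕ.<⇒≢ (ℕ.^-monoʳ-< q 1<q m<n))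
  ... | tri≈ _ m≡n _ = m≡n
  ... | tri> _ _ m>n = contradiction (≡.sym e) (ℕ.<⇒≢ (ℕ.^-monoʳ-< q 1<q m>n))

  full : ∀ {W} → HasOrder (Subspace.Member W) (q ^ (4 ℕ.+ k)) → ∀ v → Subspace.Member W v
  full {W} s v
    with (w , w∈) , e ← injective⇒surjective (Subsetoid ≈ᴹ-setoid (Subspace.Member W)) ≈ᴹ-setoid
                          s sizeV proj₁ id v
    = Subspace.resp W e w∈

  vector-outside : ∀ {W : Subspace} {n} → Decidable (Subspace.Member W) →
    HasOrder (Subspace.Member W) (q ^ n) → n ≢ 4 ℕ.+ k →
    ∃[ v ] ¬ Subspace.Member W v
  vector-outside {W} W? s n≢ with finite-any? ≈ᴹ-setoid sizeV
                                   (λ e ¬p p → ¬p (Subspace.resp W (≈ᴹ-sym e) p)) (¬? ∘ W?)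
  ... | yes v = v
  ... | no ¬v = contradiction (q^-injective (sizes-agree (Subsetoid ≈ᴹ-setoid (Subspace.Member W)) ≈ᴹ-setoid
      (bijective⇒inverse _ _ proj₁ id id
        (λ v → (v , decidable-stable (W? v) (λ v∉ → ¬v (v , v∉))) , ≈ᴹ-refl)) s sizeV)) n≢

  ⊕⟨⟩? : ∀ (W : Subspace) → Decidable (Subspace.Member W) → ∀ w → Decidable (Subspace.Member (W ⊕⟨ w ⟩))
  ⊕⟨⟩? W W? w v = map′
    (λ (c , p) → c , _ , p , ≈ᴹ-sym (≈ᴹ-trans (+ᴹ-assoc _ _ _) (≈ᴹ-trans (+ᴹ-congˡ (+ᴹ-comm _ _))
        (≈ᴹ-trans (≈ᴹ-sym (+ᴹ-assoc _ _ _)) (+-cancelʳ-*ₗ v c w)))))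
    (λ (c , s , s∈ , e) → c , Subspace.resp W (≈ᴹ-sym (move-*ₗ e)) s∈)
    (finite-any? R.setoid sizeF (λ c≈d → Subspace.resp W (+ᴹ-congˡ (*ₗ-congʳ (R.-‿cong c≈d))))
      (λ c → W? (v +ᴹ (- c) *ₗ w)))

  module Mult {_·_ : Carrierᴹ → Carrierᴹ → Carrierᴹ} {1ᴹ : Carrierᴹ} (isField : FieldStructure _·_ 1ᴹ) where
    open FieldStructure isField
    infixl 7 _∙_
    _∙_ = _·_

    ·-congʳ : ∀ {x y z} → x ≈ᴹ y → x ∙ z ≈ᴹ y ∙ z
    ·-congʳ e = ≈ᴹ-trans (·-comm _ _) (≈ᴹ-trans (·-congˡ e) (·-comm _ _))

    ·-distribʳ : ∀ x y z → (y +ᴹ z) ∙ x ≈ᴹ y ∙ x +ᴹ z ∙ x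
    ·-distribʳ x y z = ≈ᴹ-trans (·-comm _ _) (≈ᴹ-trans (·-distribˡ x y z) (+ᴹ-cong (·-comm _ _) (·-comm _ _)))

    *ₗ-· : ∀ a x y → (a *ₗ x) ∙ y ≈ᴹ a *ₗ (x ∙ y)
    *ₗ-· a x y = ≈ᴹ-trans (·-comm _ _) (≈ᴹ-trans (·-*ₗ y a x) (*ₗ-congˡ (·-comm _ _)))

    ·-identityˡ : ∀ x → 1ᴹ ∙ x ≈ᴹ x
    ·-identityˡ x = ≈ᴹ-trans (·-comm _ _) (·-identityʳ x)

    ·-zeroʳ : ∀ x → x ∙ 0ᴹ ≈ᴹ 0ᴹ
    ·-zeroʳ x = ≈ᴹ-trans (·-congˡ (≈ᴹ-sym (*ₗ-zeroˡ x))) (≈ᴹ-trans (·-*ₗ x 0# x) (*ₗ-zeroˡ _))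

    *1-· : ∀ a x → (a *ₗ 1ᴹ) ∙ x ≈ᴹ a *ₗ x
    *1-· a x = ≈ᴹ-trans (*ₗ-· a 1ᴹ x) (*ₗ-congˡ (·-identityˡ x))

    divide : ∀ {x} → ¬ (x ≈ᴹ 0ᴹ) → ∀ y → ∃[ z ] x ∙ z ≈ᴹ y
    divide {x} x≉0 y = let z , xz = ·-inverse x≉0 in
      z ∙ y , ≈ᴹ-trans (≈ᴹ-sym (·-assoc x z y)) (≈ᴹ-trans (·-congʳ xz) (·-identityˡ y))

    ·-cancelˡ : ∀ {x y z} → ¬ (x ≈ᴹ 0ᴹ) → x ∙ y ≈ᴹ x ∙ z → y ≈ᴹ z
    ·-cancelˡ {x} {y} {z} x≉0 e = let w , xw = ·-inverse x≉0 in begin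
      y            ≈⟨ ·-identityˡ y ⟨
      1ᴹ ∙ y       ≈⟨ ·-congʳ (≈ᴹ-trans (·-comm w x) xw) ⟨
      w ∙ x ∙ y    ≈⟨ ·-assoc w x y ⟩
      w ∙ (x ∙ y)  ≈⟨ ·-congˡ e ⟩
      w ∙ (x ∙ z)  ≈⟨ ·-assoc w x z ⟨
      w ∙ x ∙ z    ≈⟨ ·-congʳ (≈ᴹ-trans (·-comm w x) xw) ⟩
      1ᴹ ∙ z       ≈⟨ ·-identityˡ z ⟩
      z            ∎

    ·-nonzero : ∀ {x y} → ¬ (x ≈ᴹ 0ᴹ) → ¬ (y ≈ᴹ 0ᴹ) → ¬ (x ∙ y ≈ᴹ 0ᴹ)
    ·-nonzero x≉0 y≉0 e = y≉0 (·-cancelˡ x≉0 (≈ᴹ-trans e (≈ᴹ-sym (·-zeroʳ _))))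

    stable-surjective : ∀ (W : Subspace) {n p} → HasOrder (Subspace.Member W) n → ¬ (p ≈ᴹ 0ᴹ) →
      (∀ {w} → Subspace.Member W w → Subspace.Member W (p ∙ w)) →
      ∀ {w} → Subspace.Member W w → ∃[ x ] Subspace.Member W x × p ∙ x ≈ᴹ w
    stable-surjective W {p = p} s p≉0 pW {w} w∈ =
      let members = Subsetoid ≈ᴹ-setoid (Subspace.Member W)
          (x , x∈) , e = injective⇒surjective members members s s
                           (λ (x , x∈) → p ∙ x , pW x∈) (·-cancelˡ p≉0) (w , w∈)
      in x , x∈ , e

    -- Multiplication by p maps the finite W injectively into itself, hence onto itself. So pw is px
    -- for some x in W, and cancelling p gives w = x.
    stable-divide : ∀ (W : Subspace) {n p} → HasOrder (Subspace.Member W) n → ¬ (p ≈ᴹ 0ᴹ) →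
      (∀ {w} → Subspace.Member W w → Subspace.Member W (p ∙ w)) →
      ∀ {w} → Subspace.Member W (p ∙ w) → Subspace.Member W w
    stable-divide W s p≉0 pW pw∈ = let x , x∈ , e = stable-surjective W s p≉0 pW pw∈ in
      Subspace.resp W (·-cancelˡ p≉0 e) x∈

    -- The position of S relative to u⁻¹S.

    module Codimension2 (S : Subspace) (S? : Decidable (Subspace.Member S))
                        (sizeS : HasOrder (Subspace.Member S) (q ^ (2 ℕ.+ k)))
                        {u : Carrierᴹ} (u∉ : ¬ Subspace.Member (0-space ⊕⟨ 1ᴹ ⟩) u) where
      private module S = Subspace S

      u≉0 : ¬ (u ≈ᴹ 0ᴹ)
      u≉0 u≈0 = u∉ (⊕⟨⟩-⊇ 0-space 1ᴹ u≈0)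

      u-c : Carrier → Carrierᴹ
      u-c c = u +ᴹ (- c) *ₗ 1ᴹ

      u-c-· : ∀ c x → u-c c ∙ x ≈ᴹ u ∙ x +ᴹ (- c) *ₗ x
      u-c-· c x = ≈ᴹ-trans (·-distribʳ x u _) (+ᴹ-congˡ (*1-· (- c) x))

      u-c≉0 : ∀ c → ¬ (u-c c ≈ᴹ 0ᴹ)
      u-c≉0 c e = u∉ (- (- c) , _ , e , ≈ᴹ-sym (+-cancelʳ-*ₗ u (- c) 1ᴹ))

      u-c-stable : ∀ (W : Subspace) → (∀ {w} → Subspace.Member W w → Subspace.Member W (u ∙ w)) → ∀ c →
        ∀ {w} → Subspace.Member W w → Subspace.Member W (u-c c ∙ w)
      u-c-stable W uW c w∈ = Subspace.resp W (≈ᴹ-sym (u-c-· c _))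
        (Subspace.+-closed W (uW w∈) (Subspace.*ₗ-closed W (- c) w∈))

      -- u acts on the line (W + ⟨w⟩)/W as a scalar c, so u − c maps w into W; but u − c ≠ 0 is invertible.
      no-stable-hyperplane : ∀ (W : Subspace) {n} → HasOrder (Subspace.Member W) n →
        (∀ {w} → Subspace.Member W w → Subspace.Member W (u ∙ w)) →
        ∀ {w} → Subspace.Member (W ⊕⟨ w ⟩) (u ∙ w) → Subspace.Member W w
      no-stable-hyperplane W s uW {w} (c , v , v∈ , e) = stable-divide W s (u-c≉0 c) (u-c-stable W uW c)
        (Subspace.resp W (≈ᴹ-sym (≈ᴹ-trans (u-c-· c w) (move-*ₗ e))) v∈)

      -- This is u⁻¹S, written as a preimage so that membership involves no inverse.
      S⁻ : Subspace
      S⁻ = record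
        { Member = λ x → u ∙ x ∈ S.Member
        ; resp = λ e → S.resp (·-congˡ e)
        ; 0-closed = S.resp (≈ᴹ-sym (·-zeroʳ u)) S.0-closed
        ; +-closed = λ p p′ → S.resp (≈ᴹ-sym (·-distribˡ u _ _)) (S.+-closed p p′)
        ; *ₗ-closed = λ a p → S.resp (≈ᴹ-sym (·-*ₗ u a _)) (S.*ₗ-closed a p) }
      private module S⁻ = Subspace S⁻

      S⁻? : Decidable S⁻.Member
      S⁻? x = S? (u ∙ x)

      sizeS⁻ : HasOrder S⁻.Member (q ^ (2 ℕ.+ k))
      sizeS⁻ = size-transport _ _ (bijective⇒inverse
        (Subsetoid ≈ᴹ-setoid S⁻.Member) (Subsetoid ≈ᴹ-setoid S.Member)
        (λ (x , p) → u ∙ x , p) ·-congˡ (·-cancelˡ u≉0)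
        (λ (s , s∈) → let x , e = divide u≉0 s in (x , S.resp (≈ᴹ-sym e) s∈) , e)) sizeS

      T : Subspace
      T = record
        { Member = S.Member ∩ S⁻.Member
        ; resp = λ e (p , p′) → S.resp e p , S⁻.resp e p′
        ; 0-closed = S.0-closed , S⁻.0-closed
        ; +-closed = λ (p , p′) (r , r′) → S.+-closed p r , S⁻.+-closed p′ r′
        ; *ₗ-closed = λ a (p , p′) → S.*ₗ-closed a p , S⁻.*ₗ-closed a p′ }
      module T = Subspace T

      T? : Decidable T.Member
      T? x = S? x ×-dec S⁻? x

      private
        orderT : ∃[ n ] HasOrder T.Member n
        orderT = size-decidable ≈ᴹ-setoid sizeV T.resp T?

      -- T = S ∩ u⁻¹S has codimension 2, 3 or 4 in V.
      data Position : Set where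
        equal : (∀ {s} → s ∈ S.Member → u ∙ s ∈ S.Member) → HasOrder T.Member (q ^ (2 ℕ.+ k)) → Position
        meet  : ∀ {t} → ¬ (t ∈ S.Member) → t ∈ S⁻.Member → S⁻.Member ⊆ Subspace.Member (S ⊕⟨ t ⟩) →
                HasOrder T.Member (q ^ (1 ℕ.+ k)) → Position
        span  : HasOrder T.Member (q ^ k) → Position

      private
        cancel-q : ∀ {n m} → q ℕ.* n ≡ q ℕ.* m → n ≡ m
        cancel-q = ℕ.*-cancelˡ-≡ _ _ q {{ℕ.>-nonZero (ℕ.<-trans ℕ.z<s 1<q)}}

        outside? : ∀ (W : Subspace) → Decidable (Subspace.Member W) →
          Dec (∃[ t ] t ∈ S⁻.Member × ¬ Subspace.Member W t)
        outside? W W? = finite-any? ≈ᴹ-setoid sizeV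
          (λ e (p , ¬p′) → S⁻.resp e p , λ p′ → ¬p′ (Subspace.resp W (≈ᴹ-sym e) p′)) (λ x → S⁻? x ×-dec ¬? (W? x))

        inside : ∀ {W : Subspace} → Decidable (Subspace.Member W) →
          ¬ (∃[ t ] t ∈ S⁻.Member × ¬ Subspace.Member W t) → S⁻.Member ⊆ Subspace.Member W
        inside W? ¬t {x} p = decidable-stable (W? x) (λ x∉ → ¬t (x , p , x∉))

      -- Vectors t and t′ of u⁻¹S are added to S until the sum contains u⁻¹S; two always suffice, as
      -- S has codimension 2. Adding the same vectors to T gives u⁻¹S itself, so each of them
      -- accounts for one factor q between the orders of T and u⁻¹S.
      position : Position
      position with outside? S S?
      ... | no ¬t = equal (λ s∈ → S⊆S⁻ s∈) (size-≐ ≈ᴹ-setoid ((λ p → S⁻⊆S p , p) , proj₂) sizeS⁻)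
        where
        S⁻⊆S : S⁻.Member ⊆ S.Member
        S⁻⊆S = inside {S} S? ¬t
        S⊆S⁻ : S.Member ⊆ S⁻.Member
        S⊆S⁻ = same-size⇒⊇ ≈ᴹ-setoid S⁻.resp sizeS⁻ sizeS S⁻⊆S
      ... | yes (t , t∈ , t∉) with outside? (S ⊕⟨ t ⟩) (⊕⟨⟩? S S? t)
      ... | no ¬t′ = meet t∉ t∈ S⁻⊆H (≡.subst (HasOrder T.Member) order (proj₂ orderT))
        where
        S⁻⊆H : S⁻.Member ⊆ Subspace.Member (S ⊕⟨ t ⟩)
        S⁻⊆H = inside {S ⊕⟨ t ⟩} (⊕⟨⟩? S S? t) ¬t′
        T⊕t⊆ : Subspace.Member (T ⊕⟨ t ⟩) ⊆ S⁻.Member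
        T⊕t⊆ = ⊕⟨⟩-⊆ T S⁻ proj₂ t∈
        ⊆T⊕t : S⁻.Member ⊆ Subspace.Member (T ⊕⟨ t ⟩)
        -- This is the modular law: x and ct lie in u⁻¹S, so s = x - ct does too, and s ∈ S already.
        ⊆T⊕t x∈ with c , s , s∈ , e ← S⁻⊆H x∈ =
          c , s , (s∈ , S⁻.resp (move-*ₗ e) (S⁻.+-closed x∈ (S⁻.*ₗ-closed (- c) t∈))) , e
        order : proj₁ orderT ≡ q ^ (1 ℕ.+ k)
        order = cancel-q (size-unique (Subsetoid ≈ᴹ-setoid S⁻.Member)
          (size-≐ ≈ᴹ-setoid (T⊕t⊆ , ⊆T⊕t) (size-⊕⟨⟩ T (t∉ ∘ proj₁) (proj₂ orderT))) sizeS⁻)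
      ... | yes (t′ , t′∈ , t′∉) = span (≡.subst (HasOrder T.Member) order (proj₂ orderT))
        where
        T⊕t⊕t′ = T ⊕⟨ t ⟩ ⊕⟨ t′ ⟩
        all : ∀ v → Subspace.Member (S ⊕⟨ t ⟩ ⊕⟨ t′ ⟩) v
        all = full {S ⊕⟨ t ⟩ ⊕⟨ t′ ⟩} (size-⊕⟨⟩ (S ⊕⟨ t ⟩) t′∉ (size-⊕⟨⟩ S t∉ sizeS))
        T⊕⊆ : Subspace.Member T⊕t⊕t′ ⊆ S⁻.Member
        T⊕⊆ = ⊕⟨⟩-⊆ (T ⊕⟨ t ⟩) S⁻ (⊕⟨⟩-⊆ T S⁻ proj₂ t∈) t′∈
        ⊆T⊕ : S⁻.Member ⊆ Subspace.Member T⊕t⊕t′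
        ⊆T⊕ {x} x∈ with d , v , (c , s , s∈ , e) , e′ ← all x =
          d , v , (c , s , (s∈ , S⁻.resp (move-*ₗ e) (S⁻.+-closed
              (S⁻.resp (move-*ₗ e′) (S⁻.+-closed x∈ (S⁻.*ₗ-closed (- d) t′∈)))
              (S⁻.*ₗ-closed (- c) t∈))) , e) , e′
        T⊕t⊆S⊕t : Subspace.Member (T ⊕⟨ t ⟩) ⊆ Subspace.Member (S ⊕⟨ t ⟩)
        T⊕t⊆S⊕t = ⊕⟨⟩-⊆ T (S ⊕⟨ t ⟩) (⊕⟨⟩-⊇ S t ∘ proj₁) (∈⊕⟨⟩ S t)
        order : proj₁ orderT ≡ q ^ k
        order = cancel-q (cancel-q (size-unique (Subsetoid ≈ᴹ-setoid S⁻.Member)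
          (size-≐ ≈ᴹ-setoid (T⊕⊆ , ⊆T⊕)
            (size-⊕⟨⟩ (T ⊕⟨ t ⟩) (t′∉ ∘ T⊕t⊆S⊕t) (size-⊕⟨⟩ T (t∉ ∘ proj₁) (proj₂ orderT)))) sizeS⁻))

      module _ (L : Subspace) (1∈L : Subspace.Member L 1ᴹ) (u∈L : Subspace.Member L u) where
        private
          u²-du-c : Carrier → Carrier → Carrierᴹ
          u²-du-c d c = (u ∙ u +ᴹ (- d) *ₗ u) +ᴹ (- c) *ₗ 1ᴹ

          u²-du-c-· : ∀ d c x → u²-du-c d c ∙ x ≈ᴹ (u ∙ (u ∙ x) +ᴹ (- d) *ₗ (u ∙ x)) +ᴹ (- c) *ₗ x
          u²-du-c-· d c x = ≈ᴹ-trans (·-distribʳ x _ _) (+ᴹ-cong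
            (≈ᴹ-trans (·-distribʳ x _ _) (+ᴹ-cong (·-assoc u u x) (*ₗ-· (- d) u x))) (*1-· (- c) x))

        -- On the plane V/S the images of w, uw and u²w are dependent, so a monic polynomial of degree at
        -- most 2 in u maps w into S; it is invertible unless it vanishes.
        stable⇒¬¬quadratic : (∀ {s} → s ∈ S.Member → u ∙ s ∈ S.Member) → ¬ ¬ Subspace.Member L (u ∙ u)
        stable⇒¬¬quadratic uS uu∉ with w , w∉ ← vector-outside {S} {2 ℕ.+ k} S? sizeS (λ ())
          with ⊕⟨⟩? S S? w (u ∙ w)
        ... | yes uw∈ = contradiction (no-stable-hyperplane S sizeS uS uw∈) w∉
        -- V = S + ⟨w⟩ + ⟨uw⟩, so u²w = s + cw + d(uw), and u² - du - c takes w to s. Were this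
        -- element zero, u² = du + c would lie in L.
        ... | no uw∉ with d , v , (c , s , s∈ , e) , e′ ← full {S ⊕⟨ w ⟩ ⊕⟨ u ∙ w ⟩}
                (size-⊕⟨⟩ (S ⊕⟨ w ⟩) uw∉ (size-⊕⟨⟩ S w∉ sizeS)) (u ∙ (u ∙ w)) =
          contradiction (stable-divide S sizeS p≉0 pS
            (S.resp (≈ᴹ-sym (≈ᴹ-trans (u²-du-c-· d c w) (≈ᴹ-trans (+ᴹ-congʳ (move-*ₗ e′)) (move-*ₗ e)))) s∈)) w∉
          where
          pS : ∀ {s} → s ∈ S.Member → u²-du-c d c ∙ s ∈ S.Member
          pS s∈ = S.resp (≈ᴹ-sym (u²-du-c-· d c _))
            (S.+-closed (S.+-closed (uS (uS s∈)) (S.*ₗ-closed _ (uS s∈))) (S.*ₗ-closed _ s∈))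
          p≉0 : ¬ (u²-du-c d c ≈ᴹ 0ᴹ)
          p≉0 p≈0 = uu∉ (Subspace.resp L (+-cancelʳ-*ₗ _ (- d) u) (Subspace.+-closed L
            (Subspace.resp L (+-cancelʳ-*ₗ _ (- c) 1ᴹ) (Subspace.+-closed L
              (Subspace.resp L (≈ᴹ-sym p≈0) (Subspace.0-closed L)) (Subspace.*ₗ-closed L _ 1∈L)))
            (Subspace.*ₗ-closed L _ u∈L)))

      -- With u² = α + βu, the vector us − βs of S⁻ shows uS ⊆ S + S⁻, so S + S⁻ is u-stable.
      quadratic⇒¬meet : ∀ {α β} → u ∙ u ≈ᴹ α *ₗ 1ᴹ +ᴹ β *ₗ u →
        ∀ {t} → ¬ (t ∈ S.Member) → t ∈ S⁻.Member → ¬ (S⁻.Member ⊆ Subspace.Member (S ⊕⟨ t ⟩))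
      -- `H` is S + u⁻¹S, of codimension 1. For w outside it, V = `H` + ⟨w⟩ contains uw, and
      -- `no-stable-hyperplane` puts w back into `H`.
      quadratic⇒¬meet {α} {β} u²≈ {t} t∉ t∈ S⁻⊆H = w∉ (no-stable-hyperplane H sizeH uH
          (full {H ⊕⟨ w ⟩} (size-⊕⟨⟩ H w∉ sizeH) (u ∙ w)))
        where
        H = S ⊕⟨ t ⟩
        sizeH : HasOrder (Subspace.Member H) (q ^ (3 ℕ.+ k))
        sizeH = size-⊕⟨⟩ S t∉ sizeS
        outside = vector-outside {H} {3 ℕ.+ k} (⊕⟨⟩? S S? t) sizeH (λ ())
        w = proj₁ outside
        w∉ = proj₂ outside
        uS⊆H : ∀ {s} → s ∈ S.Member → Subspace.Member H (u ∙ s)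
        uS⊆H {s} s∈ = Subspace.resp H (+-cancelʳ-*ₗ _ (- β) s) (Subspace.+-closed H
          (S⁻⊆H {u ∙ s +ᴹ (- β) *ₗ s} (S.resp (≈ᴹ-sym (≈ᴹ-trans (·-distribˡ u _ _)
            (≈ᴹ-trans (+ᴹ-congˡ (·-*ₗ u _ s)) (move-*ₗ (begin
            u ∙ (u ∙ s)                      ≈⟨ ·-assoc u u s ⟨
            u ∙ u ∙ s                        ≈⟨ ·-congʳ u²≈ ⟩
            (α *ₗ 1ᴹ +ᴹ β *ₗ u) ∙ s          ≈⟨ ·-distribʳ s _ _ ⟩
            (α *ₗ 1ᴹ) ∙ s +ᴹ (β *ₗ u) ∙ s    ≈⟨ +ᴹ-cong (*1-· α s) (*ₗ-· β u s) ⟩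
            α *ₗ s +ᴹ β *ₗ (u ∙ s)           ∎))))) (S.*ₗ-closed α s∈)))
          (Subspace.*ₗ-closed H (- (- β)) (⊕⟨⟩-⊇ S t s∈)))
        uH : ∀ {h} → Subspace.Member H h → Subspace.Member H (u ∙ h)
        uH (c , s , s∈ , e) = Subspace.resp H
          (≈ᴹ-sym (≈ᴹ-trans (·-congˡ e) (≈ᴹ-trans (·-distribˡ u _ _) (+ᴹ-congˡ (·-*ₗ u c t)))))
          (Subspace.+-closed H (uS⊆H s∈) (Subspace.*ₗ-closed H c (⊕⟨⟩-⊇ S t t∈)))

-- Translates of L and its stabiliser.

module LineOrbit (F : HeytingField 0ℓ 0ℓ 0ℓ) {q : ℕ} (sizeF : FieldOfOrder F q) (1<q : 1 ℕ.< q)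
             (V : LeftModule (fieldRing F) 0ℓ 0ℓ)
             {k : ℕ} (dimV : ProjectiveGeometry.ProjectiveDim F V (3 ℕ.+ k))
             (L : ProjectiveGeometry.Line F V)
             {_·_ : LeftModule.Carrierᴹ V → LeftModule.Carrierᴹ V → LeftModule.Carrierᴹ V}
             (isField : SingerField.FieldStructure F sizeF V dimV _·_ (proj₁ (proj₂ L) zero)) where
  open Field F sizeF 1<q V dimV
  open Mult isField
  open FieldStructure isField

  private
    W = proj₁ L
    b = proj₁ (proj₂ L)
    module L = Subspace W
  1ᴹ u : Carrierᴹ
  1ᴹ = b zero
  u = b (suc zero)

  L? : Decidable L.Member
  L? = member? W (proj₂ L)

  sizeL : HasOrder L.Member (q ^ 2)
  sizeL = size-subspace W (proj₂ L)

  1∈L : 1ᴹ ∈ L.Member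
  1∈L = proj₁ (proj₂ (proj₂ L)) zero

  u∈L : u ∈ L.Member
  u∈L = proj₁ (proj₂ (proj₂ L)) (suc zero)

  spans : ∀ {v} → v ∈ L.Member → ∃[ c ] ∃[ d ] v ≈ᴹ c *ₗ 1ᴹ +ᴹ d *ₗ u
  spans v∈ = let c , e = proj₂ (proj₂ (proj₂ (proj₂ L))) v∈ in
    c zero , c (suc zero) , ≈ᴹ-trans e (+ᴹ-congˡ (+ᴹ-identityʳ _))

  u∉ : ¬ Subspace.Member (0-space ⊕⟨ 1ᴹ ⟩) u
  -- A scalar u would have the coordinates (0, 1) and (c, 0) in the basis of L; comparing the second
  -- ones gives 1 = 0 in F.
  u∉ (c , s , s≈0 , u≈) = 1≉0 (begin
    1ᴹ         ≈⟨ *ₗ-identityˡ 1ᴹ ⟨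
    1# *ₗ 1ᴹ   ≈⟨ *ₗ-congʳ (basis-injective {b = b} (proj₁ (proj₂ (proj₂ (proj₂ L))))
                              {c = 0# ∷ 1# ∷ []} {d = c ∷ 0# ∷ []} (begin
       0# *ₗ 1ᴹ +ᴹ (1# *ₗ u +ᴹ 0ᴹ)  ≈⟨ +ᴹ-cong (*ₗ-zeroˡ 1ᴹ) (+ᴹ-identityʳ _) ⟩
       0ᴹ +ᴹ 1# *ₗ u                ≈⟨ +ᴹ-identityˡ _ ⟩
       1# *ₗ u                      ≈⟨ *ₗ-identityˡ u ⟩
       u                            ≈⟨ u≈ ⟩
       s +ᴹ c *ₗ 1ᴹ                 ≈⟨ +ᴹ-congʳ s≈0 ⟩
       0ᴹ +ᴹ c *ₗ 1ᴹ                ≈⟨ +ᴹ-comm _ _ ⟩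
       c *ₗ 1ᴹ +ᴹ 0ᴹ                ≈⟨ +ᴹ-congˡ (≈ᴹ-trans (+ᴹ-identityʳ _) (*ₗ-zeroˡ u)) ⟨
       c *ₗ 1ᴹ +ᴹ (0# *ₗ u +ᴹ 0ᴹ)  ∎) (suc zero)) ⟩
    0# *ₗ 1ᴹ   ≈⟨ *ₗ-zeroˡ 1ᴹ ⟩
    0ᴹ         ∎)

  _·L : Carrierᴹ → Subspace
  x ·L = record
    { Member = λ v → ∃[ l ] l ∈ L.Member × v ≈ᴹ x ∙ l
    ; resp = λ e (l , l∈ , p) → l , l∈ , ≈ᴹ-trans (≈ᴹ-sym e) p
    ; 0-closed = 0ᴹ , L.0-closed , ≈ᴹ-sym (·-zeroʳ x)
    ; +-closed = λ (l , l∈ , p) (m , m∈ , p′) → l +ᴹ m , L.+-closed l∈ m∈ ,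
        ≈ᴹ-trans (+ᴹ-cong p p′) (≈ᴹ-sym (·-distribˡ x l m))
    ; *ₗ-closed = λ a (l , l∈ , p) → a *ₗ l , L.*ₗ-closed a l∈ , ≈ᴹ-trans (*ₗ-congˡ p) (≈ᴹ-sym (·-*ₗ x a l)) }

  lincomb-· : ∀ x {n} c (b : Vector Carrierᴹ n) → x ∙ lincomb c b ≈ᴹ lincomb c (λ i → x ∙ b i)
  lincomb-· x = lincomb-map (·-zeroʳ x) (·-distribˡ x) (·-*ₗ x)

  translate : ∀ {x} → ¬ (x ≈ᴹ 0ᴹ) → Line
  translate {x} x≉0 with b∈ , indep , spanning ← proj₂ (proj₂ L) = x ·L , (λ i → x ∙ b i)
    , (λ i → b i , b∈ i , ≈ᴹ-refl)
    , (λ c e → indep c (·-cancelˡ x≉0 (≈ᴹ-trans (lincomb-· x c b) (≈ᴹ-trans e (≈ᴹ-sym (·-zeroʳ x))))))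
    , λ (l , l∈ , e) → let c , l≈ = spanning l∈ in c , ≈ᴹ-trans e (≈ᴹ-trans (·-congˡ l≈) (lincomb-· x c b))

  infix 4 _~_
  _~_ : Carrierᴹ → Carrierᴹ → Set
  x ~ y = Subspace.Member (x ·L) ≐ Subspace.Member (y ·L)

  ≈⇒~ : ∀ {x y} → x ≈ᴹ y → x ~ y
  ≈⇒~ e = (λ (l , l∈ , p) → l , l∈ , ≈ᴹ-trans p (·-congʳ e))
        , (λ (l , l∈ , p) → l , l∈ , ≈ᴹ-trans p (·-congʳ (≈ᴹ-sym e)))

  ·L-scale : ∀ {x y z} → x ~ y → z ∙ x ~ z ∙ y
  ·L-scale {x} {y} {z} (x⊆y , y⊆x) = go x⊆y , go y⊆x
    where
    go : ∀ {x y} → Subspace.Member (x ·L) ⊆ Subspace.Member (y ·L) →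
         Subspace.Member ((z ∙ x) ·L) ⊆ Subspace.Member ((z ∙ y) ·L)
    go x⊆y (l , l∈ , p) = let m , m∈ , e = x⊆y (l , l∈ , ≈ᴹ-refl) in
      m , m∈ , ≈ᴹ-trans p (≈ᴹ-trans (·-assoc z _ l) (≈ᴹ-trans (·-congˡ e) (≈ᴹ-sym (·-assoc z _ m))))

  ⊆? : ∀ {x y} → ¬ (y ≈ᴹ 0ᴹ) → Dec (Subspace.Member (x ·L) ⊆ Subspace.Member (y ·L))
  ⊆? {x} {y} y≉0 = map′
    (λ b⊆ {v} (l , l∈ , e) → let c , l≈ = proj₂ (proj₂ (proj₂ (proj₂ L))) l∈ in
       Subspace.resp (y ·L) (≈ᴹ-sym (≈ᴹ-trans e (≈ᴹ-trans (·-congˡ l≈) (lincomb-· x c b))))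
         (lincomb∈ (y ·L) c (λ i → x ∙ b i) b⊆))
    (λ x⊆y i → x⊆y (b i , proj₁ (proj₂ (proj₂ L)) i , ≈ᴹ-refl))
    (Fin.all? λ i → member? (y ·L) (proj₂ (translate y≉0)) (x ∙ b i))

  InStabiliser : Pred Carrierᴹ 0ℓ
  InStabiliser x = x ~ 1ᴹ

  1·L : Subspace.Member (1ᴹ ·L) ≐ L.Member
  1·L = (λ (l , l∈ , e) → L.resp (≈ᴹ-sym (≈ᴹ-trans e (·-identityˡ l))) l∈)
      , (λ {l} l∈ → l , l∈ , ≈ᴹ-sym (·-identityˡ l))

  -- Closure is enough for equality: multiplication by x is injective on the finite L, hence onto.
  stabilises : ∀ {x} → ¬ (x ≈ᴹ 0ᴹ) → (∀ {l} → l ∈ L.Member → x ∙ l ∈ L.Member) → InStabiliser x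
  stabilises {x} x≉0 xL = ≐-trans
    ( (λ (l , l∈ , e) → L.resp (≈ᴹ-sym e) (xL l∈))
    , (λ l∈ → let m , m∈ , e = stable-surjective W sizeL x≉0 xL l∈ in m , m∈ , ≈ᴹ-sym e)) (≐-sym 1·L)

  stabiliser⊆L : ∀ {x} → InStabiliser x → ∀ {l} → l ∈ L.Member → x ∙ l ∈ L.Member
  stabiliser⊆L (x⊆ , _) {l} l∈ = proj₁ 1·L (x⊆ (l , l∈ , ≈ᴹ-refl))

  -- L = ⟨1, u⟩ is now closed under multiplication, so its nonzero elements stabilise it. Conversely
  -- x = x1 lies in L whenever xL = L.
  order-stabiliser-quadratic : u ∙ u ∈ L.Member → ∃[ g ] HasNonzeroOrder InStabiliser g × suc g ≡ q ^ 2
  order-stabiliser-quadratic uu∈ = let g , s , e = size-nonzero W sizeL in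
    g , size-≐ ≈ᴹ-setoid ((λ (x≉0 , x∈) → x≉0 , stabilises x≉0 (closed x∈))
                        , (λ (x≉0 , st) → x≉0 , L.resp (·-identityʳ _) (stabiliser⊆L st 1∈L))) s , e
    where
    closed : ∀ {x y} → x ∈ L.Member → y ∈ L.Member → x ∙ y ∈ L.Member
    closed {x} {y} x∈ y∈ with c , d , e ← spans x∈ = L.resp (≈ᴹ-sym (begin
        x ∙ y                            ≈⟨ ·-congʳ e ⟩
        (c *ₗ 1ᴹ +ᴹ d *ₗ u) ∙ y          ≈⟨ ·-distribʳ y _ _ ⟩
        (c *ₗ 1ᴹ) ∙ y +ᴹ (d *ₗ u) ∙ y    ≈⟨ +ᴹ-cong (*1-· c y) (*ₗ-· d u y) ⟩
        c *ₗ y +ᴹ d *ₗ (u ∙ y)           ∎)) (L.+-closed (L.*ₗ-closed c y∈) (L.*ₗ-closed d (uL y∈)))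
      where
      uL : ∀ {y} → y ∈ L.Member → u ∙ y ∈ L.Member
      uL {y} y∈ with c , d , e ← spans y∈ = L.resp (≈ᴹ-sym (begin
        u ∙ y                            ≈⟨ ·-congˡ e ⟩
        u ∙ (c *ₗ 1ᴹ +ᴹ d *ₗ u)          ≈⟨ ·-distribˡ u _ _ ⟩
        u ∙ (c *ₗ 1ᴹ) +ᴹ u ∙ (d *ₗ u)    ≈⟨ +ᴹ-cong (≈ᴹ-trans (·-*ₗ u c 1ᴹ) (*ₗ-congˡ (·-identityʳ u))) (·-*ₗ u d u) ⟩
        c *ₗ u +ᴹ d *ₗ (u ∙ u)           ∎)) (L.+-closed (L.*ₗ-closed c u∈L) (L.*ₗ-closed d uu∈))

  -- If xL = L, then x = x1 = c + du lies in L, and so does xu - cu = du². A nonzero d would give u²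
  -- ∈ L, so the stabiliser consists of the nonzero scalars.
  order-stabiliser-nonquadratic : ¬ (u ∙ u ∈ L.Member) → ∃[ g ] HasNonzeroOrder InStabiliser g × suc g ≡ q
  order-stabiliser-nonquadratic uu∉ =
    let g , s , e = size-nonzero (0-space ⊕⟨ 1ᴹ ⟩) (size-⊕⟨⟩ 0-space 1≉0 size-0-space) in
    g , size-≐ ≈ᴹ-setoid ((λ (x≉0 , x∈) → x≉0 , stabilises x≉0 (scalar x∈))
                        , (λ (x≉0 , st) → x≉0 , scalar⁻ st)) s , ≡.trans e (ℕ.*-identityʳ q)
    where
    scalar : ∀ {x} → Subspace.Member (0-space ⊕⟨ 1ᴹ ⟩) x → ∀ {l} → l ∈ L.Member → x ∙ l ∈ L.Member
    scalar {x} (c , s , s≈0 , e) {l} l∈ = L.resp (≈ᴹ-sym (≈ᴹ-trans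
      (·-congʳ (≈ᴹ-trans e (≈ᴹ-trans (+ᴹ-congʳ s≈0) (+ᴹ-identityˡ _)))) (*1-· c l))) (L.*ₗ-closed c l∈)
    scalar⁻ : ∀ {x} → InStabiliser x → Subspace.Member (0-space ⊕⟨ 1ᴹ ⟩) x
    scalar⁻ {x} st with c , d , e ← spans (L.resp (·-identityʳ x) (stabiliser⊆L st 1∈L)) with d ≈? 0#
    ... | yes d≈0 = c , d *ₗ u , ≈ᴹ-trans (*ₗ-congʳ d≈0) (*ₗ-zeroˡ u) , ≈ᴹ-trans e (+ᴹ-comm _ _)
    ... | no d≉0 = contradiction (L.resp (*ₗ-cancelˡ (proj₂ (inverse d≉0))) (L.*ₗ-closed _ (L.resp
          (move-*ₗ (begin
            x ∙ u                            ≈⟨ ·-congʳ e ⟩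
            (c *ₗ 1ᴹ +ᴹ d *ₗ u) ∙ u          ≈⟨ ·-distribʳ u _ _ ⟩
            (c *ₗ 1ᴹ) ∙ u +ᴹ (d *ₗ u) ∙ u    ≈⟨ +ᴹ-cong (*1-· c u) (*ₗ-· d u u) ⟩
            c *ₗ u +ᴹ d *ₗ (u ∙ u)           ≈⟨ +ᴹ-comm _ _ ⟩
            d *ₗ (u ∙ u) +ᴹ c *ₗ u           ∎))
          (L.+-closed (stabiliser⊆L st u∈L) (L.*ₗ-closed (- c) u∈L))))) uu∉

  -- Counting the lines of the orbit through a point and inside S.

  module _ (ℒ : LineSet) (ℒ⇒ : ∀ {M} → ℒ M → ∃[ x ] ∃ λ (x≉0 : ¬ (x ≈ᴹ 0ᴹ)) → M ≋ translate x≉0)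
           (⇒ℒ : ∀ {x} (x≉0 : ¬ (x ≈ᴹ 0ᴹ)) → ℒ (translate x≉0)) where

    -- Lines of the orbit are classes of nonzero vectors, and every class is a coset of the stabiliser.
    count-lines : ∀ {C : LineSet} {Q : Pred Carrierᴹ 0ℓ} →
      (∀ {x M} (x≉0 : ¬ (x ≈ᴹ 0ᴹ)) → M ≋ translate x≉0 → C M → Q x) →
      (∀ {x} (x≉0 : ¬ (x ≈ᴹ 0ᴹ)) → Q x → C (translate x≉0)) →
      ∀ {n g} → HasNonzeroOrder Q n → HasNonzeroOrder InStabiliser g →
      ∃[ N ] #Lines (ℒ ∩ C) N × N ℕ.* g ≡ n
    count-lines {C} {Q} C⇒Q Q⇒C {n} {g} sX sG =
      N , size-transport _ (Quotient X ~-eq) (Symmetry.inverse lines) sN ,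
      size-unique X (size-fibres X index index-cong fibre) sX
      where
      X : Setoid 0ℓ 0ℓ
      X = Subsetoid ≈ᴹ-setoid (λ x → ¬ (x ≈ᴹ 0ᴹ) × Q x)
      module X = Setoid X
      ~-eq : IsEquivalence {A = X.Carrier} (λ x y → proj₁ x ~ proj₁ y)
      ~-eq = record { refl = ≐-refl ; sym = ≐-sym ; trans = ≐-trans }
      quotient-size : ∃[ N ] HasSize (Quotient X ~-eq) N
      quotient-size = size-quotient X sX ~-eq ≈⇒~
        (λ (x , x≉0 , _) (y , y≉0 , _) → ⊆? y≉0 ×-dec ⊆? x≉0)
      N : ℕ
      N = proj₁ quotient-size
      sN : HasSize (Quotient X ~-eq) N
      sN = proj₂ quotient-size
      lines : Inverse (Quotient X ~-eq) (On.setoid {B = ∃ (ℒ ∩ C)} lineSetoid proj₁)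
      lines = bijective⇒inverse _ _ (λ (x , x≉0 , Qx) → translate x≉0 , ⇒ℒ x≉0 , Q⇒C x≉0 Qx) id id
        (λ (M , ℒM , CM) → let x , x≉0 , M≋ = ℒ⇒ ℒM in (x , x≉0 , C⇒Q x≉0 M≋ CM) , ≐-sym M≋)
      index : X.Carrier → Fin N
      index = Inverse.to sN
      index-cong : ∀ {x y} → x X.≈ y → index x ≡ index y
      index-cong e = Inverse.to-cong sN (≈⇒~ e)
      fibre : ∀ i → HasSize (Subsetoid X (λ x → index x ≡ i)) g
      fibre i = size-transport (Subsetoid X (λ x → index x ≡ i)) _ (Symmetry.inverse (bijective⇒inverse
          (Subsetoid ≈ᴹ-setoid (λ h → ¬ (h ≈ᴹ 0ᴹ) × InStabiliser h)) _ coset ·-congˡ (·-cancelˡ x≉0) surj)) sG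
        where
        rep : X.Carrier
        rep = Inverse.from sN i
        x : Carrierᴹ
        x = proj₁ rep
        x≉0 : ¬ (x ≈ᴹ 0ᴹ)
        x≉0 = proj₁ (proj₂ rep)
        x·~x : ∀ {h} → InStabiliser h → x ∙ h ~ x
        x·~x st = ≐-trans (·L-scale st) (≈⇒~ (·-identityʳ x))
        coset : ∃ (λ h → ¬ (h ≈ᴹ 0ᴹ) × InStabiliser h) → ∃ (λ y → index y ≡ i)
        coset (h , h≉0 , st) =
          -- `Q` passes from x to xh through `C`, since both vectors give the same line.
          (x ∙ h , ·-nonzero x≉0 h≉0 , C⇒Q (·-nonzero x≉0 h≉0) (≐-sym (x·~x st)) (Q⇒C x≉0 (proj₂ (proj₂ rep)))) ,
          ≡.trans (Inverse.to-cong sN (x·~x st)) (Inverse.strictlyInverseˡ sN i)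
        surj : ∀ (y : ∃ (λ y → index y ≡ i)) → ∃[ h ] proj₁ (proj₁ (coset h)) ≈ᴹ proj₁ (proj₁ y)
        surj ((y , y≉0 , Qy) , y∈) =
          (h , (λ h≉0 → y≉0 (≈ᴹ-trans (≈ᴹ-sym xh) (≈ᴹ-trans (·-congˡ h≉0) (·-zeroʳ x)))) , st) , xh
          where
          h = proj₁ (divide x≉0 y)
          xh = proj₂ (divide x≉0 y)
          x⁻¹ = proj₁ (·-inverse x≉0)
          x⁻¹x : x⁻¹ ∙ x ≈ᴹ 1ᴹ
          x⁻¹x = ≈ᴹ-trans (·-comm _ _) (proj₂ (·-inverse x≉0))
          y~x : y ~ x
          y~x = ≐-trans (≐-sym (Inverse.strictlyInverseʳ sN (y , y≉0 , Qy)))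
                  (≡.subst (λ j → proj₁ (Inverse.from sN (index (y , y≉0 , Qy))) ~ proj₁ (Inverse.from sN j))
                    y∈ ≐-refl)
          -- Here h = x⁻¹y, and yL = xL gives hL = x⁻¹xL = L.
          st : InStabiliser h
          st = ≐-trans (≈⇒~ (·-cancelˡ x≉0 (≈ᴹ-trans xh (begin
                   y               ≈⟨ ·-identityˡ y ⟨
                   1ᴹ ∙ y          ≈⟨ ·-congʳ (proj₂ (·-inverse x≉0)) ⟨
                   x ∙ x⁻¹ ∙ y     ≈⟨ ·-assoc x x⁻¹ y ⟩
                   x ∙ (x⁻¹ ∙ y)   ∎))))
               (≐-trans (·L-scale y~x) (≈⇒~ x⁻¹x))

    -- In p = xl with p ≠ 0, the vectors x and l determine each other. So the x with p ∈ xL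
    -- correspond to the q² - 1 nonzero l in L, and each line is counted g times.
    lines-through-point : ∀ (P : Point) {g} → HasNonzeroOrder InStabiliser g →
      ∃[ N ] #Lines (ℒ ∩ (P lies-in_)) N × suc (N ℕ.* g) ≡ q ^ 2
    lines-through-point P@(WP , bP , bP∈ , indep , spansP) sG =
      let n , sL , n+1 = size-nonzero W sizeL
          N , sN , N*g = count-lines {P lies-in_} {λ x → Subspace.Member (x ·L) p}
            (λ x≉0 M≋ P⊆M → proj₁ M≋ (P⊆M (bP∈ zero)))
            (λ {x} x≉0 p∈ v∈ → let c , e = spansP v∈ in
               Subspace.resp (x ·L) (≈ᴹ-sym e) (lincomb∈ (x ·L) c bP λ { zero → p∈ }))
            (size-transport _ (Subsetoid ≈ᴹ-setoid (λ l → ¬ (l ≈ᴹ 0ᴹ) × l ∈ L.Member)) pencil sL) sG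
      in N , sN , ≡.trans (≡.cong suc N*g) n+1
      where
      p = bP zero
      p≉0 : ¬ (p ≈ᴹ 0ᴹ)
      p≉0 p≈0 = 1≉0 (≈ᴹ-trans (≈ᴹ-sym (*ₗ-identityˡ 1ᴹ)) (≈ᴹ-trans (*ₗ-congʳ
        (indep (λ _ → 1#) (≈ᴹ-trans (+ᴹ-identityʳ _) (≈ᴹ-trans (*ₗ-identityˡ p) p≈0)) zero)) (*ₗ-zeroˡ 1ᴹ)))
      factor≉0 : ∀ {x l} → p ≈ᴹ x ∙ l → ¬ (l ≈ᴹ 0ᴹ)
      factor≉0 {x} e l≈0 = p≉0 (≈ᴹ-trans e (≈ᴹ-trans (·-congˡ l≈0) (·-zeroʳ x)))
      cancelʳ : ∀ {x y l} → ¬ (l ≈ᴹ 0ᴹ) → x ∙ l ≈ᴹ y ∙ l → x ≈ᴹ y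
      cancelʳ l≉0 e = ·-cancelˡ l≉0 (≈ᴹ-trans (·-comm _ _) (≈ᴹ-trans e (·-comm _ _)))
      pencil : Inverse (Subsetoid ≈ᴹ-setoid (λ x → ¬ (x ≈ᴹ 0ᴹ) × Subspace.Member (x ·L) p))
                       (Subsetoid ≈ᴹ-setoid (λ l → ¬ (l ≈ᴹ 0ᴹ) × l ∈ L.Member))
      pencil = bijective⇒inverse _ _ (λ (x , _ , l , l∈ , e) → l , factor≉0 e , l∈)
        (λ {(x , x≉0 , l , _ , e)} {(y , _ , m , _ , e′)} x≈y →
          ·-cancelˡ x≉0 (≈ᴹ-trans (≈ᴹ-sym e) (≈ᴹ-trans e′ (·-congʳ (≈ᴹ-sym x≈y)))))
        (λ {(x , _ , l , _ , e)} {(y , _ , m , _ , e′)} l≈m →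
          cancelʳ (factor≉0 e) (≈ᴹ-trans (≈ᴹ-sym e) (≈ᴹ-trans e′ (·-congˡ (≈ᴹ-sym l≈m)))))
        (λ (l , l≉0 , l∈) → let x , e = divide l≉0 p in
          (x , (λ x≈0 → p≉0 (≈ᴹ-trans (≈ᴹ-sym e) (≈ᴹ-trans (·-congˡ x≈0) (·-zeroʳ l)))) ,
           l , l∈ , ≈ᴹ-trans (≈ᴹ-sym e) (·-comm l x)) , ≈ᴹ-refl)

    module _ (S : Space (1 ℕ.+ k)) where
      private
        module S = Subspace (proj₁ S)
      open Codimension2 (proj₁ S) (member? (proj₁ S) (proj₂ S)) (size-subspace (proj₁ S) (proj₂ S)) u∉

      private
        count-inside : ∀ {n g} → HasOrder T.Member n → HasNonzeroOrder InStabiliser g →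
          ∃[ N ] #Lines (ℒ ∩ (_lies-in S)) N × suc (N ℕ.* g) ≡ n
        count-inside sT sG =
          let n , sT′ , n+1 = size-nonzero T sT
              N , sN , N*g = count-lines {_lies-in S} {T.Member}
                (λ {x} x≉0 M≋ M⊆S → S.resp (·-identityʳ x) (M⊆S (proj₂ M≋ (1ᴹ , 1∈L , ≈ᴹ-refl)))
                              , M⊆S (proj₂ M≋ (u , u∈L , ·-comm u x)))
                (λ {x} x≉0 (x∈ , ux∈) (l , l∈ , e) → let c , d , l≈ = spans l∈ in
                  S.resp (≈ᴹ-sym (begin
                    _ ≈⟨ e ⟩
                    x ∙ l ≈⟨ ·-congˡ l≈ ⟩
                    x ∙ (c *ₗ 1ᴹ +ᴹ d *ₗ u)          ≈⟨ ·-distribˡ x _ _ ⟩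
                    x ∙ (c *ₗ 1ᴹ) +ᴹ x ∙ (d *ₗ u)    ≈⟨ +ᴹ-cong (≈ᴹ-trans (·-*ₗ x c 1ᴹ) (*ₗ-congˡ (·-identityʳ x)))
                                                          (≈ᴹ-trans (·-*ₗ x d u) (*ₗ-congˡ (·-comm x u))) ⟩
                    c *ₗ x +ᴹ d *ₗ (u ∙ x)           ∎)) (S.+-closed (S.*ₗ-closed c x∈) (S.*ₗ-closed d ux∈)))
                sT′ sG
          in N , sN , ≡.trans (≡.cong suc N*g) n+1

        order-T-quadratic : u ∙ u ∈ L.Member → HasOrder T.Member (q ^ (2 ℕ.+ k)) ⊎ HasOrder T.Member (q ^ k)
        order-T-quadratic uu∈ with position
        ... | equal _ s = inj₁ s
        ... | meet t∉ t∈ S⁻⊆ _ = contradiction (λ {x} → S⁻⊆ {x}) (quadratic⇒¬meet (proj₂ (proj₂ (spans uu∈))) t∉ t∈)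
        ... | span s = inj₂ s

        order-T-nonquadratic : ¬ (u ∙ u ∈ L.Member) → HasOrder T.Member (q ^ (1 ℕ.+ k)) ⊎ HasOrder T.Member (q ^ k)
        order-T-nonquadratic uu∉ with position
        ... | equal uS _ = contradiction uu∉ (stable⇒¬¬quadratic W 1∈L u∈L uS)
        ... | meet _ _ _ s = inj₁ s
        ... | span s = inj₂ s

      InsideCount : ℕ → Set₁
      InsideCount g = ∃[ N ] #Lines (ℒ ∩ (_lies-in S)) N × (suc (N ℕ.* g) ≡ suc g ℕ.* q ^ k ⊎ suc (N ℕ.* g) ≡ q ^ k)

      inside-quadratic : ∀ {g} → HasNonzeroOrder InStabiliser g → suc g ≡ q ^ 2 → u ∙ u ∈ L.Member → InsideCount g
      inside-quadratic sG g+1 uu∈ with order-T-quadratic uu∈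
      ... | inj₁ sT = let N , sN , e = count-inside sT sG in N , sN , inj₁ (≡.trans e
              (≡.trans (ℕ.^-distribˡ-+-* q 2 k) (≡.cong (ℕ._* q ^ k) (≡.sym g+1))))
      ... | inj₂ sT = let N , sN , e = count-inside sT sG in N , sN , inj₂ e

      inside-nonquadratic : ∀ {g} → HasNonzeroOrder InStabiliser g → suc g ≡ q → ¬ (u ∙ u ∈ L.Member) → InsideCount g
      inside-nonquadratic sG g+1 uu∉ with order-T-nonquadratic uu∉
      ... | inj₁ sT = let N , sN , e = count-inside sT sG in N , sN , inj₁ (≡.trans e
              (≡.cong (ℕ._* q ^ k) (≡.sym g+1)))
      ... | inj₂ sT = let N , sN , e = count-inside sT sG in N , sN , inj₂ e

    lines-through-point-order : ∀ {m g} → HasNonzeroOrder InStabiliser g → suc (m ℕ.* g) ≡ q ^ 2 →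
      ∀ (P : Point) → #Lines (ℒ ∩ (P lies-in_)) m
    -- g = 0 would give q² = 1. For g > 0, cancelling g makes the count at every point equal to m.
    lines-through-point-order {m} {zero} _ e = contradiction
      (≡.trans (≡.cong suc (≡.sym (ℕ.*-zeroʳ m))) e) (ℕ.<⇒≢ (ℕ.^-monoʳ-< q 1<q (ℕ.z<s {n = 1})))
    lines-through-point-order {m} {suc g} sG e P = let N , sN , e′ = lines-through-point P sG in
      ≡.subst (#Lines (ℒ ∩ (P lies-in_))) (ℕ.*-cancelʳ-≡ N m (suc g) (ℕ.suc-injective (≡.trans e′ (≡.sym e)))) sN

    -- m is 1 when L is a subfield and q + 1 otherwise; the common bound `suc q` serves the
    -- condition m < θ_{r-1,q} on a cover.
    orbit-counts : ∃[ m ] ∃[ g ] 0 ℕ.< m × m ≤ suc q × suc (m ℕ.* g) ≡ q ^ 2 ×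
      (∀ (P : Point) → #Lines (ℒ ∩ (P lies-in_)) m) × (∀ (S : Space (1 ℕ.+ k)) → InsideCount S g)
    orbit-counts with L? (u ∙ u)
    ... | yes uu∈ =
      let g , sG , g+1 = order-stabiliser-quadratic uu∈
          e = ≡.trans (≡.cong suc (ℕ.*-identityˡ g)) g+1
      in 1 , g , ℕ.z<s , ℕ.s≤s ℕ.z≤n , e , lines-through-point-order {1} sG e ,
         λ S → inside-quadratic S sG g+1 uu∈
    ... | no uu∉ =
      let g , sG , g+1 = order-stabiliser-nonquadratic uu∉
          e = ≡.trans (≡.cong (λ n → suc (suc n ℕ.* g)) (≡.sym g+1)) (≡.trans (square g) (≡.cong (_^ 2) g+1))
      in suc q , g , ℕ.z<s , ℕ.≤-refl , e , lines-through-point-order {suc q} sG e ,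
         λ S → inside-nonquadratic S sG g+1 uu∉
      where
      square : ∀ g → suc (suc (suc g) ℕ.* g) ≡ suc g ℕ.* (suc g ℕ.* 1)
      square = solve-∀

-- Geometric sums and the two prescribed numbers of lines.

module Arithmetic where
  open import Data.Nat.Base using (_+_; _*_)
  open ≡ using (refl; sym; trans; cong; cong₂; module ≡-Reasoning)

  -- This is θ_{n-1,q} for every natural n. The empty sum covers index -1, which occurs for
  -- θ_{r-4,q} when r = 3.
  geometric : ℕ → ℕ → ℕ
  geometric q n = sum (applyUpTo (q ^_) n)

  sum-applyUpTo-* : ∀ c f n → sum (applyUpTo (λ i → c * f i) n) ≡ c * sum (applyUpTo f n)
  sum-applyUpTo-* c f zero = sym (ℕ.*-zeroʳ c)
  sum-applyUpTo-* c f (suc n) = trans (cong (λ x → c * f 0 + x) (sum-applyUpTo-* c (λ i → f (suc i)) n))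
    (sym (ℕ.*-distribˡ-+ c (f 0) _))

  geometric-suc : ∀ q n → geometric q (suc n) ≡ 1 + q * geometric q n
  geometric-suc q n = cong suc (sum-applyUpTo-* q (q ^_) n)

  geometric-sum : ∀ p n → suc (p * geometric (suc p) n) ≡ suc p ^ n
  geometric-sum p zero = cong suc (ℕ.*-zeroʳ p)
  geometric-sum p (suc n) = begin
    suc (p * geometric (suc p) (suc n))  ≡⟨ cong (λ x → suc (p * x)) (geometric-suc (suc p) n) ⟩
    suc (p * (1 + suc p * g))            ≡⟨ identity p g ⟩
    suc p * suc (p * g)                  ≡⟨ cong (suc p *_) (geometric-sum p n) ⟩
    suc p * suc p ^ n                    ∎
    where
    open ≡-Reasoning
    g = geometric (suc p) n
    identity : ∀ p g → suc (p * (1 + suc p * g)) ≡ suc p * suc (p * g)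
    identity = solve-∀

  θ-geometric : ∀ q k → θ q (+ (3 + k) ℤ.- + 4) ≡ geometric q k
  θ-geometric q zero = refl
  θ-geometric q (suc k) = refl

  -- As r ≥ 3, the sum θ_{r-1,q} contains at least 1 + q + q².
  q+1<θ : ∀ q k → 1 < q → suc q < θ q (+ (3 + k) ℤ.- + 1)
  q+1<θ q k 1<q = begin-strict
    suc q                         ≡⟨ cong suc (ℕ.*-identityʳ q) ⟨
    suc (q * 1)                   <⟨ s≤s (ℕ.*-monoʳ-< q {{ℕ.>-nonZero (ℕ.<-trans ℕ.z<s 1<q)}}
                                       (s≤s (ℕ.*-mono-≤ (ℕ.<⇒≤ 1<q) (s≤s z≤n)))) ⟩
    suc (q * suc (q * suc (q * geometric q k))) ≡⟨ cong (λ x → suc (q * suc (q * x))) (geometric-suc q k) ⟨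
    suc (q * suc (q * geometric q (suc k))) ≡⟨ cong (λ x → suc (q * x)) (geometric-suc q (suc k)) ⟨
    suc (q * geometric q (2 + k)) ≡⟨ geometric-suc q (2 + k) ⟨
    geometric q (3 + k)           ∎
    where open ℕ.≤-Reasoning

  -- Here q = p + 1, so that m g = q² − 1 and p G = qᵏ − 1; g is cancelled after multiplying by p.
  module _ {p k m g N : ℕ} (1≤p : 1 ≤ p) (mg : suc (m * g) ≡ suc p ^ 2) where
    private
      G Q : ℕ
      G = geometric (suc p) k
      Q = suc p ^ k

      instance
        p≢0 : ℕ.NonZero p
        p≢0 = ℕ.>-nonZero 1≤p

      mg′ : m * g ≡ p * (2 + p)
      mg′ = ℕ.suc-injective (trans mg (identity p))
        where
        identity : ∀ p → suc p * (suc p * 1) ≡ suc (p * (2 + p))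
        identity = solve-∀

      g≢0 : ℕ.NonZero g
      g≢0 = ℕ.≢-nonZero λ { refl → ℕ.m<n⇒n≢0 (ℕ.*-mono-≤ 1≤p (s≤s {n = suc p} z≤n))
        (trans (sym mg′) (ℕ.*-zeroʳ m)) }

    -- Both sides become (q² - 1)(qᵏ - 1) when multiplied by pg, since 2 + p = q + 1 and Ng = qᵏ - 1
    -- = pG.
    lines-small : suc (N * g) ≡ Q → N * (2 + p) ≡ m * G
    lines-small Ng = ℕ.*-cancelˡ-≡ _ _ (p * g) {{ℕ.m*n≢0 p g {{p≢0}} {{g≢0}}}} (begin
      p * g * (N * (2 + p))    ≡⟨ shuffle p g N ⟩
      p * (2 + p) * (N * g)    ≡⟨ cong₂ _*_ (sym mg′) (ℕ.suc-injective (trans Ng (sym (geometric-sum p k)))) ⟩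
      m * g * (p * G)          ≡⟨ shuffle′ m g p G ⟩
      p * g * (m * G)          ∎)
      where
      open ≡-Reasoning
      shuffle : ∀ p g N → p * g * (N * (2 + p)) ≡ p * (2 + p) * (N * g)
      shuffle = solve-∀
      shuffle′ : ∀ m g p G → m * g * (p * G) ≡ p * g * (m * G)
      shuffle′ = solve-∀

    lines-large : suc (N * g) ≡ suc g * Q → N * (2 + p) ≡ m * G + (2 + p) * Q
    lines-large Ng = ℕ.*-cancelˡ-≡ _ _ (p * g) {{ℕ.m*n≢0 p g {{p≢0}} {{g≢0}}}} (begin
      p * g * (N * (2 + p))    ≡⟨ shuffle p g N ⟩
      p * (2 + p) * (N * g)    ≡⟨ cong (p * (2 + p) *_) Ng′ ⟩
      p * (2 + p) * (p * G + g * Q)  ≡⟨ ℕ.*-distribˡ-+ (p * (2 + p)) (p * G) (g * Q) ⟩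
      p * (2 + p) * (p * G) + p * (2 + p) * (g * Q)  ≡⟨ cong (λ x → x * (p * G) + p * (2 + p) * (g * Q)) mg′ ⟨
      m * g * (p * G) + p * (2 + p) * (g * Q)  ≡⟨ shuffle′ m g p G Q ⟩
      p * g * (m * G + (2 + p) * Q)          ∎)
      where
      open ≡-Reasoning
      shuffle : ∀ p g N → p * g * (N * (2 + p)) ≡ p * (2 + p) * (N * g)
      shuffle = solve-∀
      shuffle′ : ∀ m g p G Q → m * g * (p * G) + p * (2 + p) * (g * Q) ≡ p * g * (m * G + (2 + p) * Q)
      shuffle′ = solve-∀
      Ng′ : N * g ≡ p * G + g * Q
      -- (g + 1)qᵏ - 1 splits as (qᵏ - 1) + gqᵏ; the second term is the source of the additional qᵏ
      -- lines.
      Ng′ = ℕ.suc-injective (trans Ng (cong (λ x → x + g * Q) (sym (geometric-sum p k))))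

  -- The sum in `ℚ` is normalised. Counts are compared as unnormalised fractions, where equality is
  -- cross multiplication, and this carries the result back.
  fromℚᵘ-homo-+ : ∀ x y → fromℚᵘ (x ℚᵘ.+ y) ≡ fromℚᵘ x ℚ.+ fromℚᵘ y
  fromℚᵘ-homo-+ x y = ℚ.toℚᵘ-injective (ℚᵘ.≃-trans (ℚ.toℚᵘ-fromℚᵘ _)
    (ℚᵘ.≃-trans (ℚᵘ.+-cong (ℚᵘ.≃-sym (ℚ.toℚᵘ-fromℚᵘ x)) (ℚᵘ.≃-sym (ℚ.toℚᵘ-fromℚᵘ y)))
      (ℚᵘ.≃-sym (ℚ.toℚᵘ-homo-+ (fromℚᵘ x) (fromℚᵘ y)))))

  fraction : ∀ {N a} q → N * suc q ≡ a → (+ N) ℚ./ 1 ≡ (+ a) ℚ./ suc q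
  fraction {N} {a} q e = ℚ.fromℚᵘ-cong {mkℚᵘ (+ N) 0} {mkℚᵘ (+ a) q} (*≡*
    (trans (sym (ℤ.pos-* N (suc q))) (trans (cong (λ n → + n) e) (sym (ℤ.*-identityʳ (+ a))))))

  fraction-+ : ∀ {N a b} q → N * suc q ≡ a + suc q * b → (+ N) ℚ./ 1 ≡ (+ a) ℚ./ suc q ℚ.+ (+ b) ℚ./ 1
  fraction-+ {N} {a} {b} q e = trans
    (ℚ.fromℚᵘ-cong {mkℚᵘ (+ N) 0} {mkℚᵘ (+ a) q ℚᵘ.+ mkℚᵘ (+ b) 0} (*≡* (begin
      + N ℤ.* + (suc q * 1)                            ≡⟨ cong (λ x → + N ℤ.* + x) (ℕ.*-identityʳ (suc q)) ⟩
      + N ℤ.* + suc q                                  ≡⟨ ℤ.pos-* N (suc q) ⟨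
      + (N * suc q)                                    ≡⟨ cong (λ n → + n) e′ ⟩
      + (a + b * suc q)                                ≡⟨⟩
      + a ℤ.+ + (b * suc q)                            ≡⟨ cong₂ ℤ._+_ (sym (ℤ.*-identityʳ (+ a))) (ℤ.pos-* b (suc q)) ⟩
      + a ℤ.* + 1 ℤ.+ + b ℤ.* + suc q                  ≡⟨ ℤ.*-identityʳ _ ⟨
      (+ a ℤ.* + 1 ℤ.+ + b ℤ.* + suc q) ℤ.* + 1        ∎)))
    (fromℚᵘ-homo-+ (mkℚᵘ (+ a) q) (mkℚᵘ (+ b) 0))
    where
    open ≡-Reasoning
    e′ : N * suc q ≡ a + b * suc q
    e′ = trans e (cong (λ x → a + x) (ℕ.*-comm (suc q) b))

open Arithmetic

-- Singer orbits as dual covers.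

prime-power>1 : ∀ {q} → IsPrimePower q → 1 < q
prime-power>1 (p , suc h , p-prime , _ , ≡.refl) = ℕ.<-≤-trans p>1
  (ℕ.≤-trans (ℕ.≤-reflexive (≡.sym (ℕ.*-identityʳ p)))
    (ℕ.*-monoʳ-≤ p (ℕ.m^n>0 p {{ℕ.>-nonZero (ℕ.<-trans ℕ.z<s p>1)}} h)))
  where
  p>1 : 1 < p
  p>1 = ℕ.nonTrivial⇒n>1 p {{prime⇒nonTrivial p-prime}}

module _ {F : HeytingField 0ℓ 0ℓ 0ℓ} {p k : ℕ} (sizeF : FieldOfOrder F (suc p)) (1<q : 1 < suc p)
         {V : LeftModule (fieldRing F) 0ℓ 0ℓ}
         (dimV : ProjectiveGeometry.ProjectiveDim F V (3 ℕ.+ k)) where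
  open SingerField F sizeF V dimV
  open GL using (⟦_⟧)
  private
    q r : ℕ
    q = suc p
    r = 3 ℕ.+ k
    0<p : 0 < p
    0<p = ℕ.≤-pred 1<q

  basis-head≉0 : ∀ {n} {b : Vector Carrierᴹ (suc n)} → LinearlyIndependent b → ¬ (b zero ≈ᴹ 0ᴹ)
  basis-head≉0 {n} {b} indep b₀≈0 = #-irrefl (indep (1# ∷ λ _ → 0#) combination zero) 1#0
    where
    open HeytingField F using (#-irrefl; heytingCommutativeRing)
    open HeytingProperties heytingCommutativeRing using (1#0)
    combination : lincomb {suc n} (1# ∷ λ _ → 0#) b ≈ᴹ 0ᴹ
    combination = ≈ᴹ-trans (+ᴹ-cong (≈ᴹ-trans (*ₗ-identityˡ _) b₀≈0)
      (lincomb-0 n (b ∘ suc))) (+ᴹ-identityˡ _)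
      where
      lincomb-0 : ∀ n (b : Vector Carrierᴹ n) → lincomb (λ _ → 0#) b ≈ᴹ 0ᴹ
      lincomb-0 zero b = ≈ᴹ-refl
      lincomb-0 (suc n) b = ≈ᴹ-trans (+ᴹ-cong (*ₗ-zeroˡ _) (lincomb-0 n (b ∘ suc))) (+ᴹ-identityˡ _)

  module _ {K : Subgroup PGL} (cyclic : IsCyclic PGL K) (regular : IsRegularOnPoints K) (L : Line) where
    private
      basis = proj₂ L
      e≉0 : ¬ (proj₁ basis zero ≈ᴹ 0ᴹ)
      e≉0 = basis-head≉0 {b = proj₁ basis} (proj₁ (proj₂ (proj₂ basis)))
    open LineOrbit F sizeF 1<q V dimV L (fieldStructure {K} cyclic regular e≉0)

    module _ {ℒ : LineSet} (orbit : ℒ ≐ Orbit K L) where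
      private
        ℒ⇒ : ∀ {M} → ℒ M → ∃[ x ] ∃[ x≉0 ] M ≋ translate {x} x≉0
        ℒ⇒ {M} ℒM with k , k∈ , image⊆ , ⊆image ← proj₁ orbit ℒM =
          -- The map k is multiplication by ke, so kL = (ke)L.
          ⟦ k ⟧ 1ᴹ , (λ ke≈0 → e≉0 (GL.injective k (≈ᴹ-trans ke≈0 (≈ᴹ-sym (GL.0ᴹ-homo k)))))
          , (λ v∈ → let l , l∈ , e = ⊆image v∈ in l , l∈ , ≈ᴹ-trans e (K-mult {K} cyclic regular e≉0 k∈ l))
          , (λ (l , l∈ , e) → image⊆ (l , l∈ , ≈ᴹ-trans e (≈ᴹ-sym (K-mult {K} cyclic regular e≉0 k∈ l))))

        ⇒ℒ : ∀ {x} (x≉0 : ¬ (x ≈ᴹ 0ᴹ)) → ℒ (translate x≉0)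
        -- Multiplication by x is ck with c nonzero, so xl = k(cl) and kl = x(dl) with d = c⁻¹: the
        -- scalar is absorbed into L.
        ⇒ℒ {x} x≉0 with k , k∈ , c , d , dc , x· ← mult-K {K} cyclic regular e≉0 x≉0 = proj₂ orbit
          (k , k∈
          , (λ (l , l∈ , e) → d *ₗ l , Subspace.*ₗ-closed (proj₁ L) d l∈ , ≈ᴹ-trans e (≈ᴹ-sym
               (≈ᴹ-trans (x· (d *ₗ l)) (≈ᴹ-trans (*ₗ-congˡ (GL.*ₗ-homo k d l))
                 (*ₗ-cancelˡ (R.trans (R.*-comm c d) dc))))))
          , (λ (l , l∈ , e) → c *ₗ l , Subspace.*ₗ-closed (proj₁ L) c l∈ ,
               ≈ᴹ-trans e (≈ᴹ-trans (x· l) (≈ᴹ-sym (GL.*ₗ-homo k c l)))))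

      orbit-dual-cover : IsDualCover r q ℒ
      orbit-dual-cover with m , g , 0<m , m≤q+1 , mg , through , inside ← orbit-counts ℒ ℒ⇒ ⇒ℒ =
        m , (0<m , ℕ.≤-<-trans m≤q+1 (q+1<θ q k 1<q) , through) ,
        λ S → let N , sN , e = inside S in N , sN , value N e
        where
        mθ : ℕ
        mθ = m ℕ.* θ q (+ r ℤ.- + 4)
        mθ≡ : m ℕ.* geometric q k ≡ mθ
        mθ≡ = ≡.cong (m ℕ.*_) (≡.sym (θ-geometric q k))
        value : ∀ N → suc (N ℕ.* g) ≡ suc g ℕ.* q ^ k ⊎ suc (N ℕ.* g) ≡ q ^ k →
          fromℕ r q N ≡ quotient r q m ℚ.+ fromℕ r q (q ^ k) ⊎ fromℕ r q N ≡ quotient r q m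
        value N (inj₁ e) = inj₁ (fraction-+ {N} {mθ} {q ^ k} q
          (≡.trans (lines-large {p} {k} {m} {g} {N} 0<p mg e) (≡.cong (ℕ._+ suc q ℕ.* q ^ k) mθ≡)))
        value N (inj₂ e) = inj₂ (fraction {N} {mθ} q (≡.trans (lines-small {p} {k} {m} {g} {N} 0<p mg e) mθ≡))

lemma2p4 : (r q : ℕ) → 3 ≤ r → IsPrimePower q →
    (F : HeytingField 0ℓ 0ℓ 0ℓ) → FieldOfOrder F q →
    (V : LeftModule (fieldRing F) 0ℓ 0ℓ) → ProjectiveGeometry.ProjectiveDim F V r →
    (ℒ : ProjectiveGeometry.LineSet F V) →
    ProjectiveGeometry.IsSingerCover F V ℒ →
    ProjectiveGeometry.IsDualCover F V r q ℒ
lemma2p4 (suc (suc (suc k))) (suc p) _ primePower F sizeF V dimV ℒ (K , (cyclic , regular) , L , orbit) =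
  orbit-dual-cover {F} {p} {k} sizeF (prime-power>1 primePower) {V} dimV {K} cyclic regular L {ℒ} orbit
lemma2p4 (suc (suc (suc k))) zero _ primePower = contradiction (prime-power>1 primePower) λ ()
lemma2p4 (suc zero) _ (s≤s ())
lemma2p4 (suc (suc zero)) _ (s≤s (s≤s ()))
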